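{- Let $a,b,c,\delta$ be strictly positive integers such that $c^2-\delta b^2=\pm1$ (i.e. $b$ and $c$ solve the Pell–Fermat equation for one of the two signs), $a$ and $c$ are coprime, and $a<c$. Let $[0,a_1,a_2,\dots,a_{n-1},a_n]$ be the continued fraction expansion of the rational number $\frac{a}{c}$. Then one of the following two equalities holds: $$\frac{c-a+b\sqrt{\delta}}{c}=[\overline{1,1,a_1-1,a_2,a_3,\dots,a_{n-1},a_n,1,1,a_n-1,a_{n-1},a_{n-2},\dots,a_2,a_1}]$$ or $$\frac{c-a+b\sqrt{\delta}}{c}=[\overline{1,1,a_1-1,a_2,a_3,\dots,a_{n-1},a_n-1,1,1,a_n,a_{n-1},a_{n-2},\dots,a_2,a_1}].$$
   Context: $[a_0,a_1,\dots,a_n]=a_0+1/(a_1+1/(\cdots+1/a_n))$, and $[\overline{u_1,\dots,u_p}]$ denotes the real number whose continued fraction expansion is purely periodic with period $(u_1,\dots,u_p)$. If some of the integers in the displayed periods are zero (which happens if $a_1=1$ or $a_n=1$), each (cyclically consecutive) triple $x,0,y$ is to be replaced by the single entry $x+y$ so as to obtain a genuine continued fraction. When $n=1$, the first period is to be read as $1,1,a_1-1,1,1,a_1-1$ and the second as $1,1,a_1-2,1,1,a_1$. -}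

module Defs where

import Data.Integer.Base as ℤ
open import Data.List.Base using (List; []; _∷_; _++_; applyUpTo; length; initLast; _∷ʳ′_; reverse; lookup)
open import Data.List.NonEmpty.Base using (List⁺; _∷_; toList)
open import Data.List.Relation.Unary.All using (All)
open import Data.Nat.Base as ℕ using (ℕ; suc; NonZero; _∸_)
open import Data.Nat.DivMod using (_mod_)
open import Data.Product.Base using (∃; ∃-syntax; _×_; _,_)
open import Data.Rational.Base as Rational hiding (NonZero)
open import Data.Rational.Properties
open import Data.Rational.Solver using (module +-*-Solver)
open import Data.Sum.Base using (_⊎_; inj₁; inj₂)
open import Function.Base using (_∘_)
open import Relation.Binary.PropositionalEquality using (_≡_; refl; sym; trans; cong; subst; subst₂)
open import Relation.Nullary using (¬_; yes; no)

fromℕ : ℕ → ℚ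
fromℕ n = ℤ.+ n / 1

fromℕ-positive : ∀ n .{{_ : NonZero n}} → Positive (fromℕ n)
fromℕ-positive n = normalize-pos n 1

-- Dedekind cuts: L q means q < x and U q means x < q.
record ℝ : Set₁ where
  field
    L U     : ℚ → Set
    L-inhab : ∃ L
    U-inhab : ∃ U
    L-down  : ∀ {q r} → q < r → L r → L q
    L-open  : ∀ {q} → L q → ∃[ r ] (q < r × L r)
    U-up    : ∀ {q r} → q < r → U q → U r
    U-open  : ∀ {r} → U r → ∃[ q ] (q < r × U q)
    disjoint : ∀ {q} → ¬ (L q × U q)
    located : ∀ {q r} → q < r → L q ⊎ U r

private
  -- The cut {q | f q ∈ x} for an increasing bijection f of ℚ with inverse g.
  pullback : (f g : ℚ → ℚ) → (∀ {q r} → q < r → f q < f r) →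
             (∀ {q r} → q < r → g q < g r) →
             (∀ q → f (g q) ≡ q) → (∀ q → g (f q) ≡ q) → ℝ → ℝ
  pullback f g f-mono g-mono fg gf x = record
    { L = λ q → X.L (f q)
    ; U = λ q → X.U (f q)
    ; L-inhab = let q , l = X.L-inhab in g q , subst X.L (sym (fg q)) l
    ; U-inhab = let q , u = X.U-inhab in g q , subst X.U (sym (fg q)) u
    ; L-down = λ q<r → X.L-down (f-mono q<r)
    ; L-open = λ {q} l → let r , fq<r , lr = X.L-open l in
        g r , subst (_< g r) (gf q) (g-mono fq<r) , subst X.L (sym (fg r)) lr
    ; U-up = λ q<r → X.U-up (f-mono q<r)
    ; U-open = λ {r} u → let q , q<fr , uq = X.U-open u in
        g q , subst (g q <_) (gf r) (g-mono q<fr) , subst X.U (sym (fg q)) uq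
    ; disjoint = X.disjoint
    ; located = λ q<r → X.located (f-mono q<r)
    }
    where module X = ℝ x

  cancel₁ : ∀ q p s → p * s ≡ 1ℚ → (q * p) * s ≡ q
  cancel₁ q p s ps = trans (*-assoc q p s) (trans (cong (q *_) ps) (*-identityʳ q))

infixl 6 _⊕_
infixl 7 _⊙_ _⊘_

-- p + x
_⊕_ : ℚ → ℝ → ℝ
p ⊕ x = pullback (_- p) (_+ p) (+-monoˡ-< (- p)) (+-monoˡ-< p)
  (λ q → trans (+-assoc q p (- p)) (trans (cong (q +_) (+-inverseʳ p)) (+-identityʳ q)))
  (λ q → trans (+-assoc q (- p) p) (trans (cong (q +_) (+-inverseˡ p)) (+-identityʳ q)))
  x

-- x / n : a rational q lies below x / n iff q n lies below x
_⊘_ : ℝ → (n : ℕ) .{{_ : NonZero n}} → ℝ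
x ⊘ n = pullback (_* p) (_* i) (*-monoˡ-<-pos p) (*-monoˡ-<-pos i)
  (λ q → cancel₁ q i p (*-inverseˡ p)) (λ q → cancel₁ q p i (*-inverseʳ p)) x
  where
  p = fromℕ n
  instance
    p>0 : Positive p
    p>0 = fromℕ-positive n
    p≢0 : Rational.NonZero p
    p≢0 = pos⇒nonZero p
  i = 1/ p
  instance
    i>0 : Positive i
    i>0 = 1/pos⇒pos p

-- n · x : a rational q lies below n · x iff q / n lies below x
_⊙_ : (n : ℕ) .{{_ : NonZero n}} → ℝ → ℝ
n ⊙ x = pullback (_* i) (_* p) (*-monoˡ-<-pos i) (*-monoˡ-<-pos p)
  (λ q → cancel₁ q p i (*-inverseʳ p)) (λ q → cancel₁ q i p (*-inverseˡ p)) x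
  where
  p = fromℕ n
  instance
    p>0 : Positive p
    p>0 = fromℕ-positive n
    p≢0 : Rational.NonZero p
    p≢0 = pos⇒nonZero p
  i = 1/ p
  instance
    i>0 : Positive i
    i>0 = 1/pos⇒pos p

diff⇒< : ∀ a b → 0ℚ < b - a → a < b
diff⇒< a b h = subst₂ _<_ (+-identityˡ a)
  (+-*-Solver.solve 2 (λ a b → (b :- a) :+ a := b) refl a b) (+-monoˡ-< a h)
  where open +-*-Solver

<⇒diff : ∀ {a b} → a < b → 0ℚ < b - a
<⇒diff {a} {b} h = subst (_< b - a) (+-inverseʳ a) (+-monoˡ-< (- a) h)

sq-< : ∀ {q r} → 0ℚ ≤ q → q < r → q * q < r * r
sq-< {q} {r} 0≤q q<r = ≤-<-trans (*-monoˡ-≤-nonNeg q (<⇒≤ q<r)) (*-monoˡ-<-pos r q<r)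
  where
  instance
    q≥0 : NonNegative q
    q≥0 = nonNegative 0≤q
    r>0 : Positive r
    r>0 = positive (≤-<-trans 0≤q q<r)

-- For q, d ≥ 0 the rational r = (q d + q + d) / (q + d + 1) lies between q
-- and √d, because
--   (q d + q + d) - q (q + d + 1)       = d - q²,
--   d (q + d + 1)² - (q d + q + d)²     = (d - q²) (d² + d + 1).
module Between (q d : ℚ) (0≤q : 0ℚ ≤ q) (0≤d : 0ℚ ≤ d) where
  open +-*-Solver
  instance
    q≥0 : NonNegative q
    q≥0 = nonNegative 0≤q
    d≥0 : NonNegative d
    d≥0 = nonNegative 0≤d

  w N K : ℚ
  w = q + d + 1ℚ
  N = q * d + q + d
  K = d * d + d + 1ℚ

  instance
    w>0 : Positive w
    w>0 = nonNeg+pos⇒pos (q + d) {{nonNeg+nonNeg⇒nonNeg q d}} 1ℚ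
    K>0 : Positive K
    K>0 = nonNeg+pos⇒pos (d * d + d)
      {{nonNeg+nonNeg⇒nonNeg (d * d) {{nonNeg*nonNeg⇒nonNeg d d}} d}} 1ℚ
    w≢0 : Rational.NonZero w
    w≢0 = pos⇒nonZero w

  i : ℚ
  i = 1/ w

  instance
    i>0 : Positive i
    i>0 = 1/pos⇒pos w
    ii>0 : Positive (i * i)
    ii>0 = pos*pos⇒pos i i

  r : ℚ
  r = N * i

  wi : w * i ≡ 1ℚ
  wi = *-inverseʳ w

  qwi : (q * w) * i ≡ q
  qwi = cancel₁ q w i wi

  rr : (N * N) * (i * i) ≡ r * r
  rr = solve 2 (λ N i → (N :* N) :* (i :* i) := (N :* i) :* (N :* i)) refl N i

  dwwii : (d * (w * w)) * (i * i) ≡ d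
  dwwii = trans
    (solve 3 (λ d w i → (d :* (w :* w)) :* (i :* i) := (d :* (w :* i)) :* (w :* i)) refl d w i)
    (trans (cong (λ e → (d * e) * e) wi)
      (trans (*-identityʳ (d * 1ℚ)) (*-identityʳ d)))

  id₁ : d - q * q ≡ N - q * w
  id₁ = solve 2 (λ q d → d :- q :* q :=
    (q :* d :+ q :+ d) :- q :* (q :+ d :+ con 1ℚ)) refl q d

  id₂ : (d - q * q) * K ≡ d * (w * w) - N * N
  id₂ = solve 2 (λ q d → (d :- q :* q) :* (d :* d :+ d :+ con 1ℚ) :=
    d :* ((q :+ d :+ con 1ℚ) :* (q :+ d :+ con 1ℚ)) :-
    (q :* d :+ q :+ d) :* (q :* d :+ q :+ d)) refl q d

  id₁′ : q * q - d ≡ q * w - N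
  id₁′ = solve 2 (λ q d → q :* q :- d :=
    q :* (q :+ d :+ con 1ℚ) :- (q :* d :+ q :+ d)) refl q d

  id₂′ : (q * q - d) * K ≡ N * N - d * (w * w)
  id₂′ = solve 2 (λ q d → (q :* q :- d) :* (d :* d :+ d :+ con 1ℚ) :=
    (q :* d :+ q :+ d) :* (q :* d :+ q :+ d) :-
    d :* ((q :+ d :+ con 1ℚ) :* (q :+ d :+ con 1ℚ))) refl q d

  below₁ : q * q < d → q < r
  below₁ h = subst (_< r) qwi
    (*-monoˡ-<-pos i (diff⇒< (q * w) N (subst (0ℚ <_) id₁ (<⇒diff h))))

  below₂ : q * q < d → r * r < d
  below₂ h = subst₂ _<_ rr dwwii (*-monoˡ-<-pos (i * i) (diff⇒< (N * N) (d * (w * w)) (subst₂ _<_ (*-zeroˡ K) id₂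
    (*-monoˡ-<-pos K (<⇒diff h)))))

  above₁ : d < q * q → r < q
  above₁ h = subst (r <_) qwi
    (*-monoˡ-<-pos i (diff⇒< N (q * w) (subst (0ℚ <_) id₁′ (<⇒diff h))))

  above₂ : d < q * q → d < r * r
  above₂ h = subst₂ _<_ dwwii rr (*-monoˡ-<-pos (i * i) (diff⇒< (d * (w * w)) (N * N) (subst₂ _<_ (*-zeroˡ K) id₂′
    (*-monoˡ-<-pos K (<⇒diff h)))))

  0<r : 0ℚ < q → 0ℚ < r
  0<r 0<q = positive⁻¹ r {{pos*pos⇒pos N {{N>0}} i}}
    where
    N>0 : Positive N
    N>0 = pos+nonNeg⇒pos (q * d + q)
      {{nonNeg+pos⇒pos (q * d) {{nonNeg*nonNeg⇒nonNeg q d}} q {{positive 0<q}}}} d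

√_ : ℕ → ℝ
√ δ = record
  { L = λ q → q < 0ℚ ⊎ q * q < d
  ; U = λ q → 0ℚ < q × d < q * q
  ; L-inhab = - 1ℚ , inj₁ (negative⁻¹ (- 1ℚ))
  ; U-inhab = d + 1ℚ , positive⁻¹ (d + 1ℚ) {{d+1>0}} , d<[d+1]²
  ; L-down = down
  ; L-open = L-open′
  ; U-up = λ { q<r (0<q , d<qq) → <-trans 0<q q<r , <-trans d<qq (sq-< (<⇒≤ 0<q) q<r) }
  ; U-open = λ { {r} (0<r , d<rr) → let module B = Between r d (<⇒≤ 0<r) 0≤d in
      B.r , B.above₁ d<rr , B.0<r 0<r , B.above₂ d<rr }
  ; disjoint = λ { (inj₁ q<0 , 0<q , _) → <-asym q<0 0<q
                 ; (inj₂ qq<d , _ , d<qq) → <-asym qq<d d<qq }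
  ; located = loc
  }
  where
  d = fromℕ δ
  instance
    d≥0 : NonNegative d
    d≥0 = normalize-nonNeg δ 1
    d+1>0 : Positive (d + 1ℚ)
    d+1>0 = nonNeg+pos⇒pos d 1ℚ
  0≤d : 0ℚ ≤ d
  0≤d = nonNegative⁻¹ d
  d<[d+1]² : d < (d + 1ℚ) * (d + 1ℚ)
  d<[d+1]² = diff⇒< d ((d + 1ℚ) * (d + 1ℚ)) (subst (0ℚ <_)
    (+-*-Solver.solve 1 (λ d → d :* d :+ d :+ con 1ℚ := (d :+ con 1ℚ) :* (d :+ con 1ℚ) :- d) refl d)
    (positive⁻¹ (d * d + d + 1ℚ) {{Between.K>0 0ℚ d ≤-refl 0≤d}}))
    where open +-*-Solver

  down : ∀ {q r} → q < r → r < 0ℚ ⊎ r * r < d → q < 0ℚ ⊎ q * q < d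
  down q<r (inj₁ r<0) = inj₁ (<-trans q<r r<0)
  down {q} q<r (inj₂ rr<d) with q <? 0ℚ
  ... | yes q<0 = inj₁ q<0
  ... | no q≮0 = inj₂ (<-trans (sq-< (≮⇒≥ q≮0) q<r) rr<d)

  L-open′ : ∀ {q} → q < 0ℚ ⊎ q * q < d → ∃[ r ] (q < r × (r < 0ℚ ⊎ r * r < d))
  L-open′ (inj₁ q<0) = let m , q<m , m<0 = <-dense q<0 in m , q<m , inj₁ m<0
  L-open′ {q} (inj₂ qq<d) with q <? 0ℚ
  ... | yes q<0 = let m , q<m , m<0 = <-dense q<0 in m , q<m , inj₁ m<0
  ... | no q≮0 = let module B = Between q d (≮⇒≥ q≮0) 0≤d in
    B.r , B.below₁ qq<d , inj₂ (B.below₂ qq<d)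

  loc : ∀ {q r} → q < r → (q < 0ℚ ⊎ q * q < d) ⊎ (0ℚ < r × d < r * r)
  loc {q} {r} q<r with q <? 0ℚ | d <? r * r
  ... | yes q<0 | _ = inj₁ (inj₁ q<0)
  ... | no q≮0 | yes d<rr = inj₂ (≤-<-trans (≮⇒≥ q≮0) q<r , d<rr)
  ... | no q≮0 | no d≮rr = inj₁ (inj₂ (<-≤-trans (sq-< (≮⇒≥ q≮0) q<r) (≮⇒≥ d≮rr)))

infix 4 _⟶_

-- s k → x as k → ∞, with |s k - x| < ε written as s k - ε < x < s k + ε.
_⟶_ : (ℕ → ℚ) → ℝ → Set
s ⟶ x = ∀ ε → 0ℚ < ε → ∃[ N ] (∀ k → N ℕ.≤ k → ℝ.L x (s k - ε) × ℝ.U x (s k + ε))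

-- Total inverse, with inv 0 = 0; it is applied only to positive rationals
-- when all partial quotients after the first are positive.
inv : ℚ → ℚ
inv q with q ≟ 0ℚ
... | yes _ = 0ℚ
... | no q≢0 = 1/_ q {{≢-nonZero q≢0}}

-- cf a₀ (a₁ ∷ … ∷ aₙ ∷ []) = [a₀, a₁, …, aₙ]
cf : ℕ → List ℕ → ℚ
cf a [] = fromℕ a
cf a (b ∷ bs) = fromℕ a + inv (cf b bs)

convergent : (ℕ → ℕ) → ℕ → ℚ
convergent u k = cf (u 0) (applyUpTo (u ∘ suc) k)

cycle : List⁺ ℕ → ℕ → ℕ
cycle (x ∷ xs) k = lookup (x ∷ xs) (k mod suc (length xs))

infix 4 _≈[_]ᵖ

-- x = [u₁, …, uₚ, u₁, …, uₚ, …]: a genuine continued fraction (all partial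
-- quotients positive) with limit x.
_≈[_]ᵖ : ℝ → List⁺ ℕ → Set
x ≈[ u ]ᵖ = All (1 ℕ.≤_) (toList u) × convergent (cycle u) ⟶ x

-- Replaces each x, 0, y by x + y.  Triples wrapping around the cyclic word are
-- not treated: a zero entry of firstPeriod or secondPeriod (for a₁, …, aₙ ≥ 1,
-- and a₁ ≥ 2 if n = 1) is never at either end.
contract : List⁺ ℕ → List⁺ ℕ
contract (x ∷ xs) = go x xs
  where
  go : ℕ → List ℕ → List⁺ ℕ
  go x [] = x ∷ []
  go x (0 ∷ y ∷ ys) = go (x ℕ.+ y) ys
  go x (y ∷ ys) = x ∷ toList (go y ys)

-- The arguments are a₁ and the list a₂, …, aₙ; below, mid = a₂, …, aₙ₋₁.

firstPeriod : ℕ → List ℕ → List⁺ ℕ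
firstPeriod a₁ as with initLast as
... | [] = 1 ∷ 1 ∷ a₁ ∸ 1 ∷ 1 ∷ 1 ∷ a₁ ∸ 1 ∷ []
... | mid ∷ʳ′ aₙ =
  1 ∷ 1 ∷ a₁ ∸ 1 ∷ mid ++ aₙ ∷ 1 ∷ 1 ∷ aₙ ∸ 1 ∷ reverse mid ++ a₁ ∷ []

secondPeriod : ℕ → List ℕ → List⁺ ℕ
secondPeriod a₁ as with initLast as
... | [] = 1 ∷ 1 ∷ a₁ ∸ 2 ∷ 1 ∷ 1 ∷ a₁ ∷ []
... | mid ∷ʳ′ aₙ =
  1 ∷ 1 ∷ a₁ ∸ 1 ∷ mid ++ aₙ ∸ 1 ∷ 1 ∷ 1 ∷ aₙ ∷ reverse mid ++ a₁ ∷ []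

{-# OPTIONS --safe #-}
-- Let M(n) = (n 1; 1 0) and W = M(a₁) ⋯ M(aₙ), so that W has first column
-- (c, a) and determinant d = ±1.  The matrix product along a word is unchanged
-- by contracting x, 0, y to x + y.  Along the two periods it is S W S Wᵀ and
-- S W Sᵀ Wᵀ with S = (2 -1; 1 0); since S is 2 e₁ e₁ᵀ plus an antisymmetric
-- matrix, these products depend only on a, c and ±d.  If σ = c² - δ b² is d
-- (resp. -d), the first (resp. second) product preserves the quadratic form
-- (c x - (c - a) y)² - δ b² y², whose positive root x / y is the number to be
-- expanded.  So the form takes finitely many values on the convergents (p, q),
-- whence p / q is within O(1 / q²) of that root.
module Submission where

open import Defs
open import Data.Fin.Base using (zero; suc; toℕ)
open import Data.Fin.Properties using (toℕ-injective; toℕ-fromℕ<; toℕ<n)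
open import Data.Integer.Base as ℤ using (ℤ; +_; -[1+_]; 0ℤ; 1ℤ; -1ℤ; _+_; _-_; _*_; -_; _^_; ∣_∣)
import Data.Integer.Properties as ℤP
open import Data.Integer.Tactic.RingSolver using (solve-∀)
open import Data.List.Base as List
  using (List; []; _∷_; _++_; reverse; initLast; _∷ʳ′_; length; lookup; applyUpTo)
open import Data.List.Membership.Propositional.Properties using (∈-lookup)
open import Data.List.NonEmpty.Base using (List⁺; _∷_; toList)
import Data.List.Properties as List
open import Data.List.Relation.Unary.All as All using (All; []; _∷_)
import Data.List.Relation.Unary.All.Properties as All
open import Data.Nat.Base as ℕ using (ℕ; NonZero; zero; suc; _≤_; _<_; z≤n; s≤s; _∸_)
open import Data.Nat.Coprimality as Coprime using (Coprime; coprime-divisor)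
open import Data.Nat.Divisibility
  using (∣-antisym; ∣-trans; ∣-reflexive; ∣1⇒≡1; ∣m+n∣m⇒∣n; ∣n⇒∣m*n; m∣m*n; n∣m*n)
open import Data.Nat.DivMod using (_mod_; [m+n]%n≡m%n; m<n⇒m%n≡m; m%n<n; m≡m%n+[m/n]*n)
import Data.Nat.Properties as ℕP
open import Data.Product.Base using (∃-syntax; _×_; _,_; proj₁; proj₂)
open import Data.Rational.Base as ℚ using (ℚ; 0ℚ; 1ℚ; _/_)
import Data.Rational.Properties as ℚP
open import Data.Rational.Solver using (module +-*-Solver)
import Data.Rational.Unnormalised.Base as ℚᵘ
import Data.Rational.Unnormalised.Properties as ℚᵘP
open import Data.Sum.Base using (_⊎_; inj₁; inj₂; [_,_]′)
open import Function.Base using (_∘_)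
open import Relation.Binary.PropositionalEquality
open import Relation.Nullary using (yes; no; contradiction)

open +-*-Solver using (solve; _:+_; _:*_; _:-_; :-_; _:=_; con)

-- Two-by-two integer matrices.

infixl 7 _∙_
infixr 6 _▹_
infix 8 _ᵀ

record Mat : Set where
  constructor mat
  field
    m₁₁ m₁₂ m₂₁ m₂₂ : ℤ

mat-cong : ∀ {a b c d a′ b′ c′ d′} → a ≡ a′ → b ≡ b′ → c ≡ c′ → d ≡ d′ →
           mat a b c d ≡ mat a′ b′ c′ d′
mat-cong refl refl refl refl = refl

1ᴹ : Mat
1ᴹ = mat 1ℤ 0ℤ 0ℤ 1ℤ

_∙_ : Mat → Mat → Mat
mat a b c d ∙ mat a′ b′ c′ d′ =
  mat (a * a′ + b * c′) (a * b′ + b * d′) (c * a′ + d * c′) (c * b′ + d * d′)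

_ᵀ : Mat → Mat
mat a b c d ᵀ = mat a c b d

det : Mat → ℤ
det (mat a b c d) = a * d - b * c

_▹_ : Mat → ℤ × ℤ → ℤ × ℤ
mat a b c d ▹ (x , y) = a * x + b * y , c * x + d * y

∙-assoc : ∀ M N K → (M ∙ N) ∙ K ≡ M ∙ (N ∙ K)
∙-assoc (mat a b c d) (mat a′ b′ c′ d′) (mat a″ b″ c″ d″) = mat-cong
  (entry a b a′ b′ c′ d′ a″ c″) (entry a b a′ b′ c′ d′ b″ d″)
  (entry c d a′ b′ c′ d′ a″ c″) (entry c d a′ b′ c′ d′ b″ d″)
  where
  entry : ∀ x y a b c d z w →
    (x * a + y * c) * z + (x * b + y * d) * w ≡ x * (a * z + b * w) + y * (c * z + d * w)
  entry = solve-∀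

∙-identityˡ : ∀ M → 1ᴹ ∙ M ≡ M
∙-identityˡ (mat a b c d) = mat-cong (top a c) (top b d) (bottom a c) (bottom b d)
  where
  top : ∀ x y → 1ℤ * x + 0ℤ * y ≡ x
  top = solve-∀
  bottom : ∀ x y → 0ℤ * x + 1ℤ * y ≡ y
  bottom = solve-∀

∙-identityʳ : ∀ M → M ∙ 1ᴹ ≡ M
∙-identityʳ (mat a b c d) = mat-cong (left a b) (right a b) (left c d) (right c d)
  where
  left : ∀ x y → x * 1ℤ + y * 0ℤ ≡ x
  left = solve-∀
  right : ∀ x y → x * 0ℤ + y * 1ℤ ≡ y
  right = solve-∀

ᵀ-∙ : ∀ M N → (M ∙ N) ᵀ ≡ N ᵀ ∙ M ᵀ
ᵀ-∙ (mat a b c d) (mat a′ b′ c′ d′) =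
  mat-cong (entry a b a′ c′) (entry c d a′ c′) (entry a b b′ d′) (entry c d b′ d′)
  where
  entry : ∀ a b x y → a * x + b * y ≡ x * a + y * b
  entry = solve-∀

det-∙ : ∀ M N → det (M ∙ N) ≡ det M * det N
det-∙ (mat a b c d) (mat a′ b′ c′ d′) = identity a b c d a′ b′ c′ d′
  where
  identity : ∀ a b c d a′ b′ c′ d′ →
    (a * a′ + b * c′) * (c * b′ + d * d′) - (a * b′ + b * d′) * (c * a′ + d * c′)
      ≡ (a * d - b * c) * (a′ * d′ - b′ * c′)
  identity = solve-∀

▹-∙ : ∀ M N v → (M ∙ N) ▹ v ≡ M ▹ N ▹ v
▹-∙ (mat a b c d) (mat a′ b′ c′ d′) (x , y) =
  cong₂ _,_ (entry a b a′ b′ c′ d′ x y) (entry c d a′ b′ c′ d′ x y)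
  where
  entry : ∀ u v a b c d x y →
    (u * a + v * c) * x + (u * b + v * d) * y ≡ u * (a * x + b * y) + v * (c * x + d * y)
  entry = solve-∀

-- Continued fraction matrices

step : ℕ → Mat
step n = mat (+ n) 1ℤ 1ℤ 0ℤ

word : List ℕ → Mat
word []       = 1ᴹ
word (n ∷ ns) = step n ∙ word ns

word-++ : ∀ xs ys → word (xs ++ ys) ≡ word xs ∙ word ys
word-++ []       ys = sym (∙-identityˡ (word ys))
word-++ (x ∷ xs) ys =
  trans (cong (step x ∙_) (word-++ xs ys)) (sym (∙-assoc (step x) (word xs) (word ys)))

-- Every `step x` is symmetric, so transposing a product of steps only reverses the order of the
-- factors.
word-reverse : ∀ xs → word (reverse xs) ≡ word xs ᵀ
word-reverse []       = refl
word-reverse (x ∷ xs) = begin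
  word (reverse (x ∷ xs))               ≡⟨ cong word (List.unfold-reverse x xs) ⟩
  word (reverse xs ++ x ∷ [])           ≡⟨ word-++ (reverse xs) (x ∷ []) ⟩
  word (reverse xs) ∙ (step x ∙ 1ᴹ)     ≡⟨ cong₂ _∙_ (word-reverse xs) (∙-identityʳ (step x)) ⟩
  word xs ᵀ ∙ step x ᵀ                  ≡⟨ ᵀ-∙ (step x) (word xs) ⟨
  (step x ∙ word xs) ᵀ                  ∎
  where open ≡-Reasoning

det-step : ∀ n → det (step n) ≡ -1ℤ
det-step n = cong (_- 1ℤ) (ℤP.*-zeroʳ (+ n))

-- Every step has determinant -1. The resulting sign later decides which of the two periods occurs.
det-word : ∀ xs → det (word xs) ≡ 1ℤ ⊎ det (word xs) ≡ -1ℤ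
det-word []       = inj₁ refl
det-word (x ∷ xs) with det-word xs
... | inj₁ d≡1  = inj₂ (trans (det-∙ (step x) (word xs)) (cong₂ _*_ (det-step x) d≡1))
... | inj₂ d≡-1 = inj₁ (trans (det-∙ (step x) (word xs)) (cong₂ _*_ (det-step x) d≡-1))

-- Contraction of zero entries.

step-zero : ∀ m n → step m ∙ (step 0 ∙ step n) ≡ step (m ℕ.+ n)
step-zero m n = mat-cong
  (trans (e₁ (+ m) (+ n)) (sym (ℤP.pos-+ m n))) (e₂ (+ m)) (e₃ (+ n)) refl
  where
  e₁ : ∀ m n → m * (0ℤ * n + 1ℤ * 1ℤ) + 1ℤ * (1ℤ * n + 0ℤ * 1ℤ) ≡ m + n
  e₁ = solve-∀
  e₂ : ∀ m → m * (0ℤ * 1ℤ + 1ℤ * 0ℤ) + 1ℤ * (1ℤ * 1ℤ + 0ℤ * 0ℤ) ≡ 1ℤ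
  e₂ = solve-∀
  e₃ : ∀ n → 1ℤ * (0ℤ * n + 1ℤ * 1ℤ) + 0ℤ * (1ℤ * n + 0ℤ * 1ℤ) ≡ 1ℤ
  e₃ = solve-∀

-- The local function of contract cannot be named.  With-abstraction turns its
-- arguments into distinct variables, so that refl determines the solution for go.
mutual
  go : ℕ → List ℕ → ℕ → List ℕ → List⁺ ℕ
  go = _

  contract-suc : ∀ x y ys →
    contract (x ∷ suc y ∷ ys) ≡ x ∷ toList (go x (suc y ∷ ys) (suc y) ys)
  contract-suc x y ys with List._∷_ (suc y) ys
  ... | _ with suc y
  ... | _ = refl

module _ (x₀ : ℕ) (xs₀ : List ℕ) where

  -- The list changes only where a zero has a right neighbour, and there `step-zero` shows that the
  -- product is preserved. A zero at the very end is left in place. The parameters `x₀` and `xs₀`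
  -- stand for the arguments of the call to `contract` in which `go` is local.
  word-go : ∀ x xs → word (toList (go x₀ xs₀ x xs)) ≡ word (x ∷ xs)
  word-go x []           = refl
  word-go x (0 ∷ [])     = refl
  word-go x (0 ∷ y ∷ ys) = begin
    word (toList (go x₀ xs₀ (x ℕ.+ y) ys))    ≡⟨ word-go (x ℕ.+ y) ys ⟩
    step (x ℕ.+ y) ∙ word ys                  ≡⟨ cong (_∙ word ys) (step-zero x y) ⟨
    step x ∙ (step 0 ∙ step y) ∙ word ys      ≡⟨ ∙-assoc (step x) (step 0 ∙ step y) (word ys) ⟩
    step x ∙ (step 0 ∙ step y ∙ word ys)      ≡⟨ cong (step x ∙_) (∙-assoc (step 0) (step y) (word ys)) ⟩
    step x ∙ (step 0 ∙ (step y ∙ word ys))    ∎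
    where open ≡-Reasoning
  word-go x (suc y ∷ ys) = cong (step x ∙_) (word-go (suc y) ys)

  -- A positive last entry `z` guarantees that every zero met has a right neighbour to merge with,
  -- and a merged entry stays positive because its left summand is. The entries of `xs` are
  -- arbitrary.
  go-positive : ∀ {x z} xs → 1 ≤ x → 1 ≤ z → All (1 ≤_) (toList (go x₀ xs₀ x (xs ++ z ∷ [])))
  go-positive {z = suc z} []   x≥1 z≥1 = x≥1 ∷ z≥1 ∷ []
  go-positive {x} (0 ∷ [])     x≥1 z≥1 = ℕP.≤-trans x≥1 (ℕP.m≤m+n x _) ∷ []
  go-positive {x} (0 ∷ y ∷ ys) x≥1 z≥1 = go-positive ys (ℕP.≤-trans x≥1 (ℕP.m≤m+n x y)) z≥1
  go-positive (suc y ∷ ys)     x≥1 z≥1 = x≥1 ∷ go-positive ys (s≤s z≤n) z≥1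

word-contract : ∀ u → word (toList (contract u)) ≡ word (toList u)
word-contract (x ∷ xs) = word-go x xs x xs

contract-positive : ∀ {x z} xs → 1 ≤ x → 1 ≤ z → All (1 ≤_) (toList (contract (x ∷ (xs ++ z ∷ []))))
contract-positive {x} {z} xs = go-positive x (xs ++ z ∷ []) xs

-- Matrices of the two periods.

-- M(n - 1) = U⁻¹ M(n) = M(n) L⁻¹ with U = (1 1; 0 1) and L = (1 0; 1 1);
-- S = M(1)² U⁻¹ and Sᵀ = L⁻¹ M(1)².
S : Mat
S = mat (+ 2) -1ℤ 1ℤ 0ℤ

11-pred : ∀ n → step 1 ∙ (step 1 ∙ step n) ≡ S ∙ step (suc n)
11-pred n = mat-cong (trans (e₁ (+ n)) (cong (λ k → + 2 * k + -1ℤ * 1ℤ) (sym (ℤP.pos-+ 1 n)))) refl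
                     (trans (e₂ (+ n)) (cong (λ k → 1ℤ * k + 0ℤ * 1ℤ) (sym (ℤP.pos-+ 1 n)))) refl
  where
  e₁ : ∀ n → 1ℤ * (1ℤ * n + 1ℤ * 1ℤ) + 1ℤ * (1ℤ * n + 0ℤ * 1ℤ) ≡ + 2 * (1ℤ + n) + -1ℤ * 1ℤ
  e₁ = solve-∀
  e₂ : ∀ n → 1ℤ * (1ℤ * n + 1ℤ * 1ℤ) + 0ℤ * (1ℤ * n + 0ℤ * 1ℤ) ≡ 1ℤ * (1ℤ + n) + 0ℤ * 1ℤ
  e₂ = solve-∀

-- This is the transpose of `11-pred`, all steps being symmetric.
pred-11 : ∀ n → step n ∙ (step 1 ∙ step 1) ≡ step (suc n) ∙ S ᵀ
pred-11 n = begin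
  step n ∙ (step 1 ∙ step 1)       ≡⟨ ∙-assoc (step n) (step 1) (step 1) ⟨
  step n ∙ step 1 ∙ step 1         ≡⟨⟩
  (step n ᵀ ∙ step 1 ᵀ) ∙ step 1 ᵀ ≡⟨ cong (_∙ step 1) (ᵀ-∙ (step 1) (step n)) ⟨
  (step 1 ∙ step n) ᵀ ∙ step 1 ᵀ   ≡⟨ ᵀ-∙ (step 1) (step 1 ∙ step n) ⟨
  (step 1 ∙ (step 1 ∙ step n)) ᵀ   ≡⟨ cong _ᵀ (11-pred n) ⟩
  (S ∙ step (suc n)) ᵀ             ≡⟨ ᵀ-∙ S (step (suc n)) ⟩
  step (suc n) ∙ S ᵀ               ∎
  where open ≡-Reasoning

word-11-pred : ∀ n xs → word (1 ∷ 1 ∷ n ∷ xs) ≡ S ∙ word (suc n ∷ xs)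
word-11-pred n xs = begin
  step 1 ∙ (step 1 ∙ (step n ∙ word xs))   ≡⟨ cong (step 1 ∙_) (∙-assoc (step 1) (step n) (word xs)) ⟨
  step 1 ∙ (step 1 ∙ step n ∙ word xs)     ≡⟨ ∙-assoc (step 1) (step 1 ∙ step n) (word xs) ⟨
  step 1 ∙ (step 1 ∙ step n) ∙ word xs     ≡⟨ cong (_∙ word xs) (11-pred n) ⟩
  S ∙ step (suc n) ∙ word xs               ≡⟨ ∙-assoc S (step (suc n)) (word xs) ⟩
  S ∙ (step (suc n) ∙ word xs)             ∎
  where open ≡-Reasoning

word-pred-11 : ∀ n xs → word (n ∷ 1 ∷ 1 ∷ xs) ≡ step (suc n) ∙ (S ᵀ ∙ word xs)
word-pred-11 n xs = begin
  step n ∙ (step 1 ∙ (step 1 ∙ word xs))   ≡⟨ cong (step n ∙_) (∙-assoc (step 1) (step 1) (word xs)) ⟨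
  step n ∙ (step 1 ∙ step 1 ∙ word xs)     ≡⟨ ∙-assoc (step n) (step 1 ∙ step 1) (word xs) ⟨
  step n ∙ (step 1 ∙ step 1) ∙ word xs     ≡⟨ cong (_∙ word xs) (pred-11 n) ⟩
  step (suc n) ∙ S ᵀ ∙ word xs             ≡⟨ ∙-assoc (step (suc n)) (S ᵀ) (word xs) ⟩
  step (suc n) ∙ (S ᵀ ∙ word xs)           ∎
  where open ≡-Reasoning

module _ (a₁ : ℕ) (mid : List ℕ) (aₙ : ℕ) where

  private
    W : Mat
    W = word (a₁ ∷ mid ++ aₙ ∷ [])

  word-reversed : word (aₙ ∷ reverse mid ++ a₁ ∷ []) ≡ W ᵀ
  word-reversed = trans (cong word reversed) (word-reverse (a₁ ∷ mid ++ aₙ ∷ []))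
    where
    reversed : aₙ ∷ reverse mid ++ a₁ ∷ [] ≡ reverse (a₁ ∷ mid ++ aₙ ∷ [])
    reversed = sym (trans (List.unfold-reverse a₁ (mid ++ aₙ ∷ []))
      (cong (_++ a₁ ∷ []) (List.reverse-++ mid (aₙ ∷ []))))

  word-split : ∀ ys → word (a₁ ∷ mid ++ aₙ ∷ ys) ≡ W ∙ word ys
  word-split ys = trans (cong (λ xs → word (a₁ ∷ xs)) (sym (List.++-assoc mid (aₙ ∷ []) ys)))
    (word-++ (a₁ ∷ mid ++ aₙ ∷ []) ys)

-- Both runs 1, 1, k - 1 turn into `S` followed by the letter k. What remains is the original word
-- once forwards and once backwards, that is, `W` and its transpose. Positivity of a₁ and aₙ makes
-- the truncated subtractions genuine.
word-firstPeriod : ∀ a₁ as → All (1 ≤_) (a₁ ∷ as) → let W = word (a₁ ∷ as) in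
  word (toList (firstPeriod a₁ as)) ≡ S ∙ (W ∙ (S ∙ W ᵀ))
word-firstPeriod (suc m) as (_ ∷ as≥1) with initLast as
... | [] = begin
  -- For n = 1 the matrix W is the symmetric matrix `A`, so the second occurrence of `A` can be read
  -- as the transpose.
  word (1 ∷ 1 ∷ m ∷ 1 ∷ 1 ∷ m ∷ [])        ≡⟨ word-11-pred m (1 ∷ 1 ∷ m ∷ []) ⟩
  S ∙ (A ∙ word (1 ∷ 1 ∷ m ∷ []))          ≡⟨ cong (λ M → S ∙ (A ∙ M)) (word-11-pred m []) ⟩
  S ∙ (A ∙ (S ∙ (A ∙ 1ᴹ)))                 ≡⟨ cong₂ (λ M N → S ∙ (M ∙ (S ∙ N))) (∙-identityʳ A)
                                                (trans (cong _ᵀ (∙-identityʳ A)) (sym (∙-identityʳ A))) ⟨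
  S ∙ (A ∙ 1ᴹ ∙ (S ∙ (A ∙ 1ᴹ) ᵀ))          ∎
  where
  open ≡-Reasoning
  A = step (suc m)
... | mid ∷ʳ′ aₙ with All.++⁻ʳ mid as≥1
...   | s≤s {n = k} _ ∷ [] = begin
  word (1 ∷ 1 ∷ m ∷ mid ++ suc k ∷ 1 ∷ 1 ∷ k ∷ reverse mid ++ suc m ∷ [])
    ≡⟨ word-11-pred m (mid ++ suc k ∷ 1 ∷ 1 ∷ k ∷ reverse mid ++ suc m ∷ []) ⟩
  S ∙ word (suc m ∷ mid ++ suc k ∷ 1 ∷ 1 ∷ k ∷ reverse mid ++ suc m ∷ [])
    ≡⟨ cong (S ∙_) (word-split (suc m) mid (suc k) (1 ∷ 1 ∷ k ∷ reverse mid ++ suc m ∷ [])) ⟩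
  S ∙ (W ∙ word (1 ∷ 1 ∷ k ∷ reverse mid ++ suc m ∷ []))
    ≡⟨ cong (λ M → S ∙ (W ∙ M)) (word-11-pred k (reverse mid ++ suc m ∷ [])) ⟩
  S ∙ (W ∙ (S ∙ word (suc k ∷ reverse mid ++ suc m ∷ [])))
    ≡⟨ cong (λ M → S ∙ (W ∙ (S ∙ M))) (word-reversed (suc m) mid (suc k)) ⟩
  S ∙ (W ∙ (S ∙ W ᵀ))
    ∎
  where
  open ≡-Reasoning
  W = word (suc m ∷ mid ++ suc k ∷ [])

-- Here the middle run is aₙ - 1, 1, 1, which is the letter aₙ followed by `S ᵀ`. For n = 1 the
-- single letter a₁ is lowered from both sides, whence the entry a₁ - 2 and the bound on a₁.
word-secondPeriod : ∀ a₁ as → All (1 ≤_) (a₁ ∷ as) → (as ≡ [] → 2 ≤ a₁) →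
  let W = word (a₁ ∷ as) in
  word (toList (secondPeriod a₁ as)) ≡ S ∙ (W ∙ (S ᵀ ∙ W ᵀ))
word-secondPeriod (suc m) as (_ ∷ as≥1) a₁≥2 with initLast as
... | [] with a₁≥2 refl
...   | s≤s (s≤s {n = k} _) = begin
  word (1 ∷ 1 ∷ k ∷ 1 ∷ 1 ∷ suc m ∷ [])    ≡⟨ word-11-pred k (1 ∷ 1 ∷ suc m ∷ []) ⟩
  S ∙ word (suc k ∷ 1 ∷ 1 ∷ suc m ∷ [])    ≡⟨ cong (S ∙_) (word-pred-11 m (suc m ∷ [])) ⟩
  S ∙ (A ∙ (S ᵀ ∙ (A ∙ 1ᴹ)))               ≡⟨ cong₂ (λ M N → S ∙ (M ∙ (S ᵀ ∙ N))) (∙-identityʳ A)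
                                                (trans (cong _ᵀ (∙-identityʳ A)) (sym (∙-identityʳ A))) ⟨
  S ∙ (A ∙ 1ᴹ ∙ (S ᵀ ∙ (A ∙ 1ᴹ) ᵀ))        ∎
  where
  open ≡-Reasoning
  A = step (suc m)
word-secondPeriod (suc m) as (_ ∷ as≥1) a₁≥2 | mid ∷ʳ′ aₙ with All.++⁻ʳ mid as≥1
...   | s≤s {n = k} _ ∷ [] = begin
  word (1 ∷ 1 ∷ m ∷ mid ++ k ∷ 1 ∷ 1 ∷ rest)
    ≡⟨ word-11-pred m (mid ++ k ∷ 1 ∷ 1 ∷ rest) ⟩
  S ∙ word ((suc m ∷ mid) ++ k ∷ 1 ∷ 1 ∷ rest)
    ≡⟨ cong (S ∙_) (word-++ (suc m ∷ mid) (k ∷ 1 ∷ 1 ∷ rest)) ⟩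
  S ∙ (word (suc m ∷ mid) ∙ word (k ∷ 1 ∷ 1 ∷ rest))
    ≡⟨ cong (λ M → S ∙ (word (suc m ∷ mid) ∙ M)) (word-pred-11 k rest) ⟩
  S ∙ (word (suc m ∷ mid) ∙ (step (suc k) ∙ (S ᵀ ∙ word rest)))
    ≡⟨ cong (S ∙_) (∙-assoc (word (suc m ∷ mid)) (step (suc k)) (S ᵀ ∙ word rest)) ⟨
  S ∙ (word (suc m ∷ mid) ∙ step (suc k) ∙ (S ᵀ ∙ word rest))
    ≡⟨ cong₂ (λ M N → S ∙ (M ∙ (S ᵀ ∙ N))) prefix (word-reversed (suc m) mid (suc k)) ⟩
  S ∙ (W ∙ (S ᵀ ∙ W ᵀ))
    ∎
  where
  open ≡-Reasoning
  W = word (suc m ∷ mid ++ suc k ∷ [])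
  rest = suc k ∷ reverse mid ++ suc m ∷ []
  prefix : word (suc m ∷ mid) ∙ step (suc k) ≡ W
  prefix = sym (trans (word-++ (suc m ∷ mid) (suc k ∷ []))
    (cong (word (suc m ∷ mid) ∙_) (∙-identityʳ (step (suc k)))))

-- By `contract-positive` only the two end entries matter. The last one is a₁, or a₁ - 1 when n = 1,
-- which is where 2 ≤ a₁ enters. Reassociating the list exposes that last entry.
firstPeriod-positive : ∀ a₁ as → All (1 ≤_) (a₁ ∷ as) → (as ≡ [] → 2 ≤ a₁) →
  All (1 ≤_) (toList (contract (firstPeriod a₁ as)))
firstPeriod-positive a₁ as (a₁≥1 ∷ _) a₁≥2 with initLast as
... | [] = contract-positive (1 ∷ a₁ ∸ 1 ∷ 1 ∷ 1 ∷ []) (s≤s z≤n) (ℕP.∸-monoˡ-≤ 1 (a₁≥2 refl))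
... | mid ∷ʳ′ aₙ = subst (λ xs → All (1 ≤_) (toList (contract (1 ∷ 1 ∷ a₁ ∸ 1 ∷ xs))))
  (List.++-assoc mid (aₙ ∷ 1 ∷ 1 ∷ aₙ ∸ 1 ∷ reverse mid) (a₁ ∷ []))
  (contract-positive (1 ∷ a₁ ∸ 1 ∷ mid ++ aₙ ∷ 1 ∷ 1 ∷ aₙ ∸ 1 ∷ reverse mid) (s≤s z≤n) a₁≥1)

secondPeriod-positive : ∀ a₁ as → All (1 ≤_) (a₁ ∷ as) →
  All (1 ≤_) (toList (contract (secondPeriod a₁ as)))
secondPeriod-positive a₁ as (a₁≥1 ∷ _) with initLast as
... | [] = contract-positive (1 ∷ a₁ ∸ 2 ∷ 1 ∷ 1 ∷ []) (s≤s z≤n) a₁≥1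
... | mid ∷ʳ′ aₙ = subst (λ xs → All (1 ≤_) (toList (contract (1 ∷ 1 ∷ a₁ ∸ 1 ∷ xs))))
  (List.++-assoc mid (aₙ ∸ 1 ∷ 1 ∷ 1 ∷ aₙ ∷ reverse mid) (a₁ ∷ []))
  (contract-positive (1 ∷ a₁ ∸ 1 ∷ mid ++ aₙ ∸ 1 ∷ 1 ∷ 1 ∷ aₙ ∷ reverse mid) (s≤s z≤n) a₁≥1)

-- The quadratic form and its automorphism

-- With w the column (c, a) and J = (0 -1; 1 0), the second factor is 2 w wᵀ + σ J.
pell : ℤ → ℤ → ℤ → Mat
pell a c σ = S ∙ mat (+ 2 * (c * c)) (+ 2 * (a * c) - σ) (+ 2 * (a * c) + σ) (+ 2 * (a * a))

-- Since S = 2 e₁ e₁ᵀ + J and W J Wᵀ = (det W) J, the second column of W enters only through the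
-- determinant.
S-congruence : ∀ c c′ a a′ → let W = mat c c′ a a′ in
  S ∙ (W ∙ (S ∙ W ᵀ)) ≡ pell a c (det W)
S-congruence c c′ a a′ =
  cong (S ∙_) (mat-cong (e₁ c c′) (e₂ c c′ a a′) (e₃ c c′ a a′) (e₁ a a′))
  where
  e₁ : ∀ x y → x * (+ 2 * x + -1ℤ * y) + y * (1ℤ * x + 0ℤ * y) ≡ + 2 * (x * x)
  e₁ = solve-∀
  e₂ : ∀ x y z w → x * (+ 2 * z + -1ℤ * w) + y * (1ℤ * z + 0ℤ * w) ≡
                   + 2 * (z * x) - (x * w - y * z)
  e₂ = solve-∀
  e₃ : ∀ x y z w → z * (+ 2 * x + -1ℤ * y) + w * (1ℤ * x + 0ℤ * y) ≡
                   + 2 * (z * x) + (x * w - y * z)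
  e₃ = solve-∀

-- Transposing S replaces J by -J, which flips the sign of the determinant term.
Sᵀ-congruence : ∀ c c′ a a′ → let W = mat c c′ a a′ in
  S ∙ (W ∙ (S ᵀ ∙ W ᵀ)) ≡ pell a c (- det W)
Sᵀ-congruence c c′ a a′ =
  cong (S ∙_) (mat-cong (e₁ c c′) (e₂ c c′ a a′) (e₃ c c′ a a′) (e₁ a a′))
  where
  e₁ : ∀ x y → x * (+ 2 * x + 1ℤ * y) + y * (-1ℤ * x + 0ℤ * y) ≡ + 2 * (x * x)
  e₁ = solve-∀
  e₂ : ∀ x y z w → x * (+ 2 * z + 1ℤ * w) + y * (-1ℤ * z + 0ℤ * w) ≡
                   + 2 * (z * x) - (- (x * w - y * z))
  e₂ = solve-∀
  e₃ : ∀ x y z w → z * (+ 2 * x + 1ℤ * y) + w * (-1ℤ * x + 0ℤ * y) ≡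
                   + 2 * (z * x) + (- (x * w - y * z))
  e₃ = solve-∀

-- y² f(x / y), where f has the roots (c - a ± √(c² - σ)) / c.
form : ℤ → ℤ → ℤ → ℤ × ℤ → ℤ
form a c σ (x , y) = (c * x - (c - a) * y) * (c * x - (c - a) * y) - (c * c - σ) * (y * y)

-- The fixed points of `pell a c σ`, acting on x / y, are the roots of the form, so the form is
-- multiplied by the determinant σ² = 1. For each sign this is a polynomial identity.
form-pell : ∀ a c {σ} → σ ≡ 1ℤ ⊎ σ ≡ -1ℤ → ∀ v → form a c σ (pell a c σ ▹ v) ≡ form a c σ v
form-pell a c (inj₁ refl) (x , y) = identity a c x y
  where
  identity : ∀ a c x y →
    let X = (+ 2 * (+ 2 * (c * c)) + -1ℤ * (+ 2 * (a * c) + 1ℤ)) * x +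
            (+ 2 * (+ 2 * (a * c) - 1ℤ) + -1ℤ * (+ 2 * (a * a))) * y
        Y = (1ℤ * (+ 2 * (c * c)) + 0ℤ * (+ 2 * (a * c) + 1ℤ)) * x +
            (1ℤ * (+ 2 * (a * c) - 1ℤ) + 0ℤ * (+ 2 * (a * a))) * y
    in (c * X - (c - a) * Y) * (c * X - (c - a) * Y) - (c * c - 1ℤ) * (Y * Y)
       ≡ (c * x - (c - a) * y) * (c * x - (c - a) * y) - (c * c - 1ℤ) * (y * y)
  identity = solve-∀
form-pell a c (inj₂ refl) (x , y) = identity a c x y
  where
  identity : ∀ a c x y →
    let X = (+ 2 * (+ 2 * (c * c)) + -1ℤ * (+ 2 * (a * c) + -1ℤ)) * x +
            (+ 2 * (+ 2 * (a * c) - -1ℤ) + -1ℤ * (+ 2 * (a * a))) * y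
        Y = (1ℤ * (+ 2 * (c * c)) + 0ℤ * (+ 2 * (a * c) + -1ℤ)) * x +
            (1ℤ * (+ 2 * (a * c) - -1ℤ) + 0ℤ * (+ 2 * (a * a))) * y
    in (c * X - (c - a) * Y) * (c * X - (c - a) * Y) - (c * c - -1ℤ) * (Y * Y)
       ≡ (c * x - (c - a) * y) * (c * x - (c - a) * y) - (c * c - -1ℤ) * (y * y)
  identity = solve-∀

-- Convergents

-- These are the continuants: `num xs` over `den xs` is the value of the continued fraction `xs`.
-- The empty list is 1 / 0, the point at infinity, so a single entry needs no separate clause.
mutual
  num : List ℕ → ℕ
  num []       = 1
  num (x ∷ xs) = x ℕ.* num xs ℕ.+ den xs

  den : List ℕ → ℕ
  den []       = 0
  den (x ∷ xs) = num xs

vec : List ℕ → ℤ × ℤ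
vec xs = + num xs , + den xs

step-vec : ∀ x xs → step x ▹ vec xs ≡ vec (x ∷ xs)
step-vec x xs = cong₂ _,_
  (trans (cong₂ _+_ (sym (ℤP.pos-* x (num xs))) (ℤP.*-identityˡ (+ den xs)))
    (sym (ℤP.pos-+ (x ℕ.* num xs) (den xs))))
  (trans (ℤP.+-identityʳ (1ℤ * + num xs)) (ℤP.*-identityˡ (+ num xs)))

-- Each step prepends one partial quotient, so the matrix of a period carries a convergent of the
-- periodic expansion to the one a full period later.
word-vec : ∀ xs ys → word xs ▹ vec ys ≡ vec (xs ++ ys)
word-vec []       ys = cong₂ _,_
  (trans (ℤP.+-identityʳ (1ℤ * + num ys)) (ℤP.*-identityˡ (+ num ys)))
  (trans (ℤP.+-identityˡ (1ℤ * + den ys)) (ℤP.*-identityˡ (+ den ys)))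
word-vec (x ∷ xs) ys = begin
  (step x ∙ word xs) ▹ vec ys   ≡⟨ ▹-∙ (step x) (word xs) (vec ys) ⟩
  step x ▹ word xs ▹ vec ys     ≡⟨ cong (step x ▹_) (word-vec xs ys) ⟩
  step x ▹ vec (xs ++ ys)       ≡⟨ step-vec x (xs ++ ys) ⟩
  vec (x ∷ xs ++ ys)            ∎
  where open ≡-Reasoning

-- The first column is the image of (1, 0), which is `vec []`.
word-column : ∀ xs → (Mat.m₁₁ (word xs) , Mat.m₂₁ (word xs)) ≡ vec xs
word-column xs = begin
  (m₁₁ , m₂₁)         ≡⟨ cong₂ _,_ (e m₁₁ m₁₂) (e m₂₁ m₂₂) ⟨
  word xs ▹ vec []    ≡⟨ word-vec xs [] ⟩
  vec (xs ++ [])      ≡⟨ cong vec (List.++-identityʳ xs) ⟩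
  vec xs              ∎
  where
  open ≡-Reasoning
  open Mat (word xs)
  e : ∀ x y → x * 1ℤ + y * 0ℤ ≡ x
  e = solve-∀

-- Growth and coprimality of continuants.

num+den≤num : ∀ {x} xs → 1 ≤ x → num xs ℕ.+ den xs ≤ num (x ∷ xs)
num+den≤num {x} xs x≥1 = ℕP.+-monoˡ-≤ (den xs) (ℕP.m≤n*m (num xs) x {{ℕ.>-nonZero x≥1}})

den≤num : ∀ {x} xs → 1 ≤ x → den (x ∷ xs) ≤ num (x ∷ xs)
den≤num xs x≥1 = ℕP.≤-trans (ℕP.m≤m+n (num xs) (den xs)) (num+den≤num xs x≥1)

num≥1 : ∀ {xs} → All (1 ≤_) xs → 1 ≤ num xs
num≥1 []                     = s≤s z≤n
num≥1 (_∷_ {xs = xs} x≥1 xs≥1) = ℕP.≤-trans (num≥1 xs≥1) (den≤num xs x≥1)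

-- Each new numerator is at least the sum of the previous numerator and denominator, so it grows by
-- at least one per entry. This linear bound supplies the rate of convergence.
mutual
  length<num+den : ∀ {xs} → All (1 ≤_) xs → length xs ℕ.< num xs ℕ.+ den xs
  length<num+den []                      = s≤s z≤n
  length<num+den {x ∷ xs} xs≥1@(_ ∷ xs≥1′) = begin-strict
    length (x ∷ xs)              ≤⟨ length≤num xs≥1 ⟩
    num (x ∷ xs)                 <⟨ ℕP.m<m+n (num (x ∷ xs)) (num≥1 xs≥1′) ⟩
    num (x ∷ xs) ℕ.+ num xs      ∎
    where open ℕP.≤-Reasoning

  length≤num : ∀ {xs} → All (1 ≤_) xs → length xs ≤ num xs
  length≤num []                         = z≤n
  length≤num {x ∷ xs} (x≥1 ∷ xs≥1) = ℕP.≤-trans (length<num+den xs≥1) (num+den≤num xs x≥1)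

-- This is the Euclidean algorithm: a common divisor passes down to the pair of the tail and finally
-- divides 1.
num-den-coprime : ∀ xs → Coprime (num xs) (den xs)
num-den-coprime []       (d∣1 , _) = ∣1⇒≡1 d∣1
num-den-coprime (x ∷ xs) (d∣xn+m , d∣n) =
  num-den-coprime xs (d∣n , ∣m+n∣m⇒∣n d∣xn+m (∣n⇒∣m*n x d∣n))

coprime-unique : ∀ {a c p q} → Coprime a c → Coprime q p → a ℕ.* p ≡ q ℕ.* c → a ≡ q × c ≡ p
coprime-unique {a} {c} {p} {q} a⊥c q⊥p eq =
  ∣-antisym (coprime-divisor a⊥c (∣-trans (m∣m*n p) (∣-reflexive (trans eq (ℕP.*-comm q c)))))
            (coprime-divisor q⊥p (∣-trans (m∣m*n c) (∣-reflexive (trans (sym eq) (ℕP.*-comm a p))))) ,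
  ∣-antisym (coprime-divisor (Coprime.sym a⊥c) (∣-trans (n∣m*n q) (∣-reflexive (sym eq))))
            (coprime-divisor (Coprime.sym q⊥p) (∣-trans (n∣m*n a) (∣-reflexive eq)))

-- Prefixes of periodic sequences.

applyUpTo-+ : ∀ {A : Set} (f : ℕ → A) m n →
  applyUpTo f (m ℕ.+ n) ≡ applyUpTo f m ++ applyUpTo (λ i → f (m ℕ.+ i)) n
applyUpTo-+ f zero    n = refl
applyUpTo-+ f (suc m) n = cong (f 0 ∷_) (applyUpTo-+ (λ i → f (suc i)) m n)

applyUpTo-cong : ∀ {A : Set} {f g : ℕ → A} → (∀ i → f i ≡ g i) → ∀ n → applyUpTo f n ≡ applyUpTo g n
applyUpTo-cong f≗g zero    = refl
applyUpTo-cong f≗g (suc n) = cong₂ _∷_ (f≗g 0) (applyUpTo-cong (λ i → f≗g (suc i)) n)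

applyUpTo-lookup : ∀ {A : Set} (f : ℕ → A) xs → (∀ i → f (toℕ i) ≡ lookup xs i) →
  applyUpTo f (length xs) ≡ xs
applyUpTo-lookup f []       eq = refl
applyUpTo-lookup f (x ∷ xs) eq =
  cong₂ _∷_ (eq zero) (applyUpTo-lookup (λ i → f (suc i)) xs (λ i → eq (suc i)))

period : List⁺ ℕ → ℕ
period u = length (toList u)

cycle-periodic : ∀ u k → cycle u (period u ℕ.+ k) ≡ cycle u k
cycle-periodic u@(x ∷ xs) k = cong (lookup (x ∷ xs)) (toℕ-injective (begin
  toℕ ((L ℕ.+ k) mod L)   ≡⟨ toℕ-fromℕ< _ ⟩
  (L ℕ.+ k) ℕ.% L           ≡⟨ cong (ℕ._% L) (ℕP.+-comm L k) ⟩
  (k ℕ.+ L) ℕ.% L           ≡⟨ [m+n]%n≡m%n k L ⟩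
  k ℕ.% L                   ≡⟨ toℕ-fromℕ< _ ⟨
  toℕ (k mod L)           ∎))
  where
  open ≡-Reasoning
  L = period u

applyUpTo-cycle : ∀ u → applyUpTo (cycle u) (period u) ≡ toList u
applyUpTo-cycle u@(x ∷ xs) = applyUpTo-lookup (cycle u) (x ∷ xs) λ i →
  cong (lookup (x ∷ xs)) (toℕ-injective (trans (toℕ-fromℕ< _) (m<n⇒m%n≡m (toℕ<n i))))

applyUpTo-cycle-+ : ∀ u k →
  applyUpTo (cycle u) (period u ℕ.+ k) ≡ toList u ++ applyUpTo (cycle u) k
applyUpTo-cycle-+ u k = trans (applyUpTo-+ (cycle u) (period u) k)
  (cong₂ _++_ (applyUpTo-cycle u) (applyUpTo-cong (cycle-periodic u) k))

cycle-positive : ∀ u → All (1 ≤_) (toList u) → ∀ k → 1 ≤ cycle u k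
cycle-positive (x ∷ xs) u≥1 k = All.lookup u≥1 (∈-lookup (k mod suc (length xs)))

bounded-below : ∀ (f : ℕ → ℕ) n → ∃[ K ] (∀ k → k ℕ.< n → f k ≤ K)
bounded-below f zero    = 0 , λ _ ()
bounded-below f (suc n) = let K , f≤K = bounded-below f n in
  f n ℕ.⊔ K , λ { k (s≤s k≤n) → [ (λ k<n → ℕP.≤-trans (f≤K k k<n) (ℕP.m≤n⊔m (f n) K))
                               , (λ { refl → ℕP.m≤m⊔n (f n) K }) ]′ (ℕP.m≤n⇒m<n∨m≡n k≤n) }

periodic-bounded : ∀ (f : ℕ → ℕ) L .{{_ : ℕ.NonZero L}} → (∀ k → f (L ℕ.+ k) ≡ f k) →
  ∃[ K ] (∀ k → f k ≤ K)
periodic-bounded f L periodic = let K , f≤K = bounded-below f L in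
  K , λ k → ℕP.≤-trans (ℕP.≤-reflexive (reduce k)) (f≤K (k ℕ.% L) (m%n<n k L))
  where
  shift : ∀ m k → f (m ℕ.* L ℕ.+ k) ≡ f k
  shift zero    k = refl
  shift (suc m) k = trans (cong f (ℕP.+-assoc L (m ℕ.* L) k))
    (trans (periodic (m ℕ.* L ℕ.+ k)) (shift m k))
  reduce : ∀ k → f k ≡ f (k ℕ.% L)
  reduce k = trans
    (cong f (trans (m≡m%n+[m/n]*n k L) (ℕP.+-comm (k ℕ.% L) (k ℕ./ L ℕ.* L)))) (shift (k ℕ./ L) (k ℕ.% L))

-- By periodicity, a prefix longer by one period is the shorter prefix with the whole period put in
-- front. The matrix of the period therefore acts from the left, and the values of the invariant `F`
-- are periodic in k.
cycle-form-bounded : ∀ (F : ℤ × ℤ → ℤ) u → (∀ v → F (word (toList u) ▹ v) ≡ F v) →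
  ∃[ K ] (∀ k → ∣ F (vec (applyUpTo (cycle u) k)) ∣ ≤ K)
cycle-form-bounded F u@(_ ∷ _) invariant = periodic-bounded _ (period u) λ k → cong ∣_∣ (begin
  F (vec (applyUpTo (cycle u) (period u ℕ.+ k)))        ≡⟨ cong (λ xs → F (vec xs)) (applyUpTo-cycle-+ u k) ⟩
  F (vec (toList u ++ applyUpTo (cycle u) k))           ≡⟨ cong F (word-vec (toList u) (applyUpTo (cycle u) k)) ⟨
  F (word (toList u) ▹ vec (applyUpTo (cycle u) k))     ≡⟨ invariant (vec (applyUpTo (cycle u) k)) ⟩
  F (vec (applyUpTo (cycle u) k))                       ∎)
  where open ≡-Reasoning

-- Rational embedding of the integers

⟦_⟧ : ℤ → ℚ
⟦ z ⟧ = z / 1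

-- Passing to unnormalised fractions with denominator 1 avoids reduction to lowest terms; the
-- compatibility laws below then become facts about integers.
⟦⟧-toℚᵘ : ∀ z → ℚ.toℚᵘ ⟦ z ⟧ ℚᵘ.≃ ℚᵘ.mkℚᵘ z 0
⟦⟧-toℚᵘ z = ℚP.toℚᵘ-fromℚᵘ (ℚᵘ.mkℚᵘ z 0)

⟦⟧-+ : ∀ m n → ⟦ m + n ⟧ ≡ ⟦ m ⟧ ℚ.+ ⟦ n ⟧
⟦⟧-+ m n = ℚP.toℚᵘ-injective (begin
  ℚ.toℚᵘ ⟦ m + n ⟧                       ≈⟨ ⟦⟧-toℚᵘ (m + n) ⟩
  ℚᵘ.mkℚᵘ (m + n) 0                      ≈⟨ ℚᵘ.*≡* (unit m n) ⟩
  ℚᵘ.mkℚᵘ m 0 ℚᵘ.+ ℚᵘ.mkℚᵘ n 0           ≈⟨ ℚᵘP.+-cong (⟦⟧-toℚᵘ m) (⟦⟧-toℚᵘ n) ⟨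
  ℚ.toℚᵘ ⟦ m ⟧ ℚᵘ.+ ℚ.toℚᵘ ⟦ n ⟧         ≈⟨ ℚP.toℚᵘ-homo-+ ⟦ m ⟧ ⟦ n ⟧ ⟨
  ℚ.toℚᵘ (⟦ m ⟧ ℚ.+ ⟦ n ⟧)               ∎)
  where
  open ℚᵘP.≃-Reasoning
  unit : ∀ m n → (m + n) * 1ℤ ≡ (m * 1ℤ + n * 1ℤ) * 1ℤ
  unit = solve-∀

⟦⟧-* : ∀ m n → ⟦ m * n ⟧ ≡ ⟦ m ⟧ ℚ.* ⟦ n ⟧
⟦⟧-* m n = ℚP.toℚᵘ-injective (begin
  ℚ.toℚᵘ ⟦ m * n ⟧                       ≈⟨ ⟦⟧-toℚᵘ (m * n) ⟩
  ℚᵘ.mkℚᵘ m 0 ℚᵘ.* ℚᵘ.mkℚᵘ n 0           ≈⟨ ℚᵘP.*-cong (⟦⟧-toℚᵘ m) (⟦⟧-toℚᵘ n) ⟨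
  ℚ.toℚᵘ ⟦ m ⟧ ℚᵘ.* ℚ.toℚᵘ ⟦ n ⟧         ≈⟨ ℚP.toℚᵘ-homo-* ⟦ m ⟧ ⟦ n ⟧ ⟨
  ℚ.toℚᵘ (⟦ m ⟧ ℚ.* ⟦ n ⟧)               ∎)
  where open ℚᵘP.≃-Reasoning

⟦⟧-neg : ∀ m → ⟦ - m ⟧ ≡ ℚ.- ⟦ m ⟧
⟦⟧-neg m = ℚP.toℚᵘ-injective (begin
  ℚ.toℚᵘ ⟦ - m ⟧         ≈⟨ ⟦⟧-toℚᵘ (- m) ⟩
  ℚᵘ.- ℚᵘ.mkℚᵘ m 0       ≈⟨ ℚᵘP.-‿cong (⟦⟧-toℚᵘ m) ⟨
  ℚᵘ.- ℚ.toℚᵘ ⟦ m ⟧      ≈⟨ ℚP.toℚᵘ-homo‿- ⟦ m ⟧ ⟨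
  ℚ.toℚᵘ (ℚ.- ⟦ m ⟧)     ∎)
  where open ℚᵘP.≃-Reasoning

⟦⟧-sub : ∀ m n → ⟦ m - n ⟧ ≡ ⟦ m ⟧ ℚ.- ⟦ n ⟧
⟦⟧-sub m n = trans (⟦⟧-+ m (- n)) (cong (⟦ m ⟧ ℚ.+_) (⟦⟧-neg n))

⟦⟧-injective : ∀ {m n} → ⟦ m ⟧ ≡ ⟦ n ⟧ → m ≡ n
⟦⟧-injective {m} {n} eq with ℚP./-injective-≃ (ℚᵘ.mkℚᵘ m 0) (ℚᵘ.mkℚᵘ n 0) eq
... | ℚᵘ.*≡* m1≡n1 = ℤP.*-cancelʳ-≡ m n 1ℤ m1≡n1

⟦⟧-mono-≤ : ∀ {m n} → m ℤ.≤ n → ⟦ m ⟧ ℚ.≤ ⟦ n ⟧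
⟦⟧-mono-≤ {m} {n} m≤n = ℚP.toℚᵘ-cancel-≤ (ℚᵘP.≤-respˡ-≃ (ℚᵘP.≃-sym (⟦⟧-toℚᵘ m))
  (ℚᵘP.≤-respʳ-≃ (ℚᵘP.≃-sym (⟦⟧-toℚᵘ n)) (ℚᵘ.*≤* (ℤP.*-monoʳ-≤-nonNeg 1ℤ m≤n))))

⟦⟧-mono-< : ∀ {m n} → m ℤ.< n → ⟦ m ⟧ ℚ.< ⟦ n ⟧
⟦⟧-mono-< {m} {n} m<n = ℚP.toℚᵘ-cancel-< (ℚᵘP.<-respˡ-≃ (ℚᵘP.≃-sym (⟦⟧-toℚᵘ m))
  (ℚᵘP.<-respʳ-≃ (ℚᵘP.≃-sym (⟦⟧-toℚᵘ n)) (ℚᵘ.*<* (ℤP.*-monoʳ-<-pos 1ℤ m<n))))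

fromℕ-* : ∀ m n → fromℕ (m ℕ.* n) ≡ fromℕ m ℚ.* fromℕ n
fromℕ-* m n = trans (cong ⟦_⟧ (ℤP.pos-* m n)) (⟦⟧-* (+ m) (+ n))

fromℕ-mono-≤ : ∀ {m n} → m ≤ n → fromℕ m ℚ.≤ fromℕ n
fromℕ-mono-≤ {m} {n} m≤n = ⟦⟧-mono-≤ {+ m} {+ n} (ℤ.+≤+ m≤n)

/-*-cancel : ∀ z n .{{_ : ℕ.NonZero n}} → (z / n) ℚ.* fromℕ n ≡ ⟦ z ⟧
/-*-cancel z n@(suc m) = ℚP.toℚᵘ-injective (begin
  ℚ.toℚᵘ ((z / n) ℚ.* fromℕ n)             ≈⟨ ℚP.toℚᵘ-homo-* (z / n) (fromℕ n) ⟩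
  ℚ.toℚᵘ (z / n) ℚᵘ.* ℚ.toℚᵘ (fromℕ n)     ≈⟨ ℚᵘP.*-cong (ℚP.toℚᵘ-fromℚᵘ (ℚᵘ.mkℚᵘ z m)) (⟦⟧-toℚᵘ (+ n)) ⟩
  ℚᵘ.mkℚᵘ z m ℚᵘ.* ℚᵘ.mkℚᵘ (+ n) 0         ≈⟨ ℚᵘ.*≡* (unit z (+ n)) ⟩
  ℚᵘ.mkℚᵘ z 0                              ≈⟨ ⟦⟧-toℚᵘ z ⟨
  ℚ.toℚᵘ ⟦ z ⟧                             ∎)
  where
  open ℚᵘP.≃-Reasoning
  unit : ∀ z n → z * n * 1ℤ ≡ z * (n * 1ℤ)
  unit = solve-∀

-- The witness is K + 1 times the denominator of ε: that denominator times ε is the numerator, which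
-- is at least 1.
archimedean : ∀ {ε} → 0ℚ ℚ.< ε → ∀ K → ∃[ N ] (fromℕ K ℚ.< fromℕ N ℚ.* ε)
archimedean {ε} 0<ε K = suc K ℕ.* ℚ.↧ₙ ε , ℚP.<-≤-trans (⟦⟧-mono-< {+ K} {+ suc K} (ℤ.+<+ ℕP.≤-refl)) (begin
  fromℕ (suc K)                                 ≡⟨ ℚP.*-identityʳ (fromℕ (suc K)) ⟨
  fromℕ (suc K) ℚ.* 1ℚ                          ≤⟨ ℚP.*-monoˡ-≤-nonNeg (fromℕ (suc K)) (⟦⟧-mono-≤ {1ℤ} {ℚ.↥ ε} (1≤↥ ε 0<ε)) ⟩
  fromℕ (suc K) ℚ.* ⟦ ℚ.↥ ε ⟧                   ≡⟨ cong (fromℕ (suc K) ℚ.*_) ε↧ ⟨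
  fromℕ (suc K) ℚ.* (ε ℚ.* fromℕ (ℚ.↧ₙ ε))      ≡⟨ cong (fromℕ (suc K) ℚ.*_) (ℚP.*-comm ε (fromℕ (ℚ.↧ₙ ε))) ⟩
  fromℕ (suc K) ℚ.* (fromℕ (ℚ.↧ₙ ε) ℚ.* ε)      ≡⟨ ℚP.*-assoc (fromℕ (suc K)) (fromℕ (ℚ.↧ₙ ε)) ε ⟨
  fromℕ (suc K) ℚ.* fromℕ (ℚ.↧ₙ ε) ℚ.* ε        ≡⟨ cong (ℚ._* ε) (fromℕ-* (suc K) (ℚ.↧ₙ ε)) ⟨
  fromℕ (suc K ℕ.* ℚ.↧ₙ ε) ℚ.* ε                ∎)
  where
  open ℚP.≤-Reasoning
  instance
    sucK≥0 : ℚ.NonNegative (fromℕ (suc K))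
    sucK≥0 = ℚP.normalize-nonNeg (suc K) 1
  1≤↥ : ∀ p → 0ℚ ℚ.< p → 1ℤ ℤ.≤ ℚ.↥ p
  1≤↥ p 0<p with ℚ.positive 0<p
  1≤↥ (ℚ.mkℚ ℤ.+[1+ n ] _ _) _ | _ = ℤ.+≤+ (s≤s z≤n)
  ε↧ : ε ℚ.* fromℕ (ℚ.↧ₙ ε) ≡ ⟦ ℚ.↥ ε ⟧
  ε↧ = trans (cong (ℚ._* fromℕ (ℚ.↧ₙ ε)) (sym (ℚP.↥p/↧p≡p ε))) (/-*-cancel (ℚ.↥ ε) (ℚ.↧ₙ ε))

-- Positivity of the tail makes every `inv` in `cf` a genuine inverse. The leading entry `a` may be
-- 0, as it is in the expansion of a / c.
cf-num-den : ∀ a {bs} → All (1 ≤_) bs →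
  cf a bs ℚ.* fromℕ (den (a ∷ bs)) ≡ fromℕ (num (a ∷ bs))
cf-num-den a []                 = begin
  fromℕ a ℚ.* fromℕ 1       ≡⟨ ℚP.*-identityʳ (fromℕ a) ⟩
  fromℕ a                   ≡⟨ cong fromℕ (trans (ℕP.+-identityʳ (a ℕ.* 1)) (ℕP.*-identityʳ a)) ⟨
  fromℕ (a ℕ.* 1 ℕ.+ 0)     ∎
  where open ≡-Reasoning
cf-num-den a {b ∷ bs} (b≥1 ∷ bs≥1) = begin
  (fromℕ a ℚ.+ inv r) ℚ.* p                      ≡⟨ ℚP.*-distribʳ-+ p (fromℕ a) (inv r) ⟩
  fromℕ a ℚ.* p ℚ.+ inv r ℚ.* p                  ≡⟨ cong (λ x → fromℕ a ℚ.* p ℚ.+ inv r ℚ.* x) (sym rq≡p) ⟩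
  fromℕ a ℚ.* p ℚ.+ inv r ℚ.* (r ℚ.* q)          ≡⟨ cong (fromℕ a ℚ.* p ℚ.+_) (inv-cancel r q r≢0) ⟩
  fromℕ a ℚ.* p ℚ.+ q                            ≡⟨ cong (ℚ._+ q) (fromℕ-* a (num (b ∷ bs))) ⟨
  fromℕ (a ℕ.* num (b ∷ bs)) ℚ.+ q               ≡⟨ ⟦⟧-+ (+ (a ℕ.* num (b ∷ bs))) (+ den (b ∷ bs)) ⟨
  fromℕ (num (a ∷ b ∷ bs))                       ∎
  where
  open ≡-Reasoning
  r = cf b bs
  p = fromℕ (num (b ∷ bs))
  q = fromℕ (den (b ∷ bs))
  rq≡p : r ℚ.* q ≡ p
  rq≡p = cf-num-den b bs≥1
  r≢0 : r ≢ 0ℚ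
  r≢0 r≡0 = ℚP.<-irrefl (trans (sym (ℚP.*-zeroˡ q)) (trans (cong (ℚ._* q) (sym r≡0)) rq≡p))
    (⟦⟧-mono-< {0ℤ} {+ num (b ∷ bs)} (ℤ.+<+ (num≥1 (b≥1 ∷ bs≥1))))
  inv-cancel : ∀ r q → r ≢ 0ℚ → inv r ℚ.* (r ℚ.* q) ≡ q
  inv-cancel r q r≢0 with r ℚP.≟ 0ℚ
  ... | yes r≡0 = contradiction r≡0 r≢0
  ... | no  r≢0 = trans (sym (ℚP.*-assoc (ℚ.1/ r) r q))
    (trans (cong (ℚ._* q) (ℚP.*-inverseˡ r)) (ℚP.*-identityˡ q))
    where instance _ = ℚ.≢-nonZero r≢0

-- Approximation

0≤* : ∀ {p q} → 0ℚ ℚ.≤ p → 0ℚ ℚ.≤ q → 0ℚ ℚ.≤ p ℚ.* q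
0≤* {p} {q} 0≤p 0≤q = ℚP.nonNegative⁻¹ (p ℚ.* q)
  {{ℚP.nonNeg*nonNeg⇒nonNeg p {{ℚ.nonNegative 0≤p}} q {{ℚ.nonNegative 0≤q}}}}

≤⇒0≤- : ∀ {p q} → p ℚ.≤ q → 0ℚ ℚ.≤ q ℚ.- p
≤⇒0≤- {p} {q} p≤q = subst (ℚ._≤ q ℚ.- p) (ℚP.+-inverseʳ p) (ℚP.+-monoˡ-≤ (ℚ.- p) p≤q)

-- With Y = X - e, the difference m - Y² is (e - (X² - m)) + e (X - 1 + Y).
square-below : ∀ {X e m} → 1ℚ ℚ.≤ X → 0ℚ ℚ.< e → X ℚ.* X ℚ.- m ℚ.< e → 0ℚ ℚ.≤ X ℚ.- e →
  (X ℚ.- e) ℚ.* (X ℚ.- e) ℚ.< m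
square-below {X} {e} {m} 1≤X 0<e X²-m<e 0≤Y = diff⇒< _ m (subst (0ℚ ℚ.<_)
  (solve 3 (λ X e m → (e :- (X :* X :- m)) :+ e :* ((X :- con 1ℚ) :+ (X :- e))
    := m :- (X :- e) :* (X :- e)) refl X e m)
  (ℚP.+-mono-<-≤ (<⇒diff X²-m<e) (0≤* (ℚP.<⇒≤ 0<e) (ℚP.+-mono-≤ (≤⇒0≤- 1≤X) 0≤Y))))

-- With Y = X + e, the difference Y² - m is (e - (m - X²)) + e (X - 1 + Y).
square-above : ∀ {X e m} → 1ℚ ℚ.≤ X → 0ℚ ℚ.< e → m ℚ.- X ℚ.* X ℚ.< e →
  m ℚ.< (X ℚ.+ e) ℚ.* (X ℚ.+ e)
square-above {X} {e} {m} 1≤X 0<e m-X²<e = diff⇒< m _ (subst (0ℚ ℚ.<_)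
  (solve 3 (λ X e m → (e :- (m :- X :* X)) :+ e :* ((X :- con 1ℚ) :+ (X :+ e))
    := (X :+ e) :* (X :+ e) :- m) refl X e m)
  (ℚP.+-mono-<-≤ (<⇒diff m-X²<e)
    (0≤* (ℚP.<⇒≤ 0<e) (ℚP.+-mono-≤ (≤⇒0≤- 1≤X) (ℚP.+-mono-≤ 0≤X (ℚP.<⇒≤ 0<e))))))
  where
  0≤X : 0ℚ ℚ.≤ X
  0≤X = ℚP.≤-trans (ℚP.nonNegative⁻¹ 1ℚ) 1≤X

module _ (a b c δ : ℕ) .{{_ : NonZero a}} .{{_ : NonZero b}} .{{_ : NonZero c}}
         (σ : ℤ) (c²-σ : + c * + c - σ ≡ + δ * (+ b * + b)) where

  private
    x : ℝ
    x = (((+ c - + a) / 1) ⊕ (b ⊙ (√ δ))) ⊘ c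

    B C E d m i : ℚ
    B = fromℕ b
    C = fromℕ c
    E = ⟦ + c - + a ⟧
    d = fromℕ δ
    m = d ℚ.* (B ℚ.* B)

    instance
      B>0 : ℚ.Positive B
      B>0 = fromℕ-positive b
      B≢0 : ℚ.NonZero B
      B≢0 = ℚP.pos⇒nonZero B
    i = ℚ.1/ B
    instance
      i>0 : ℚ.Positive i
      i>0 = ℚP.1/pos⇒pos B
      i²>0 : ℚ.Positive (i ℚ.* i)
      i²>0 = ℚP.pos*pos⇒pos i i

    square-scale : ∀ y → (y ℚ.* y) ℚ.* (i ℚ.* i) ≡ (y ℚ.* i) ℚ.* (y ℚ.* i)
    square-scale y = solve 2 (λ y i → (y :* y) :* (i :* i) := (y :* i) :* (y :* i)) refl y i

    m-scale : m ℚ.* (i ℚ.* i) ≡ d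
    m-scale = begin
      m ℚ.* (i ℚ.* i)                   ≡⟨ solve 3 (λ d B i → (d :* (B :* B)) :* (i :* i)
                                             := d :* ((B :* i) :* (B :* i))) refl d B i ⟩
      d ℚ.* ((B ℚ.* i) ℚ.* (B ℚ.* i))   ≡⟨ cong (λ e → d ℚ.* (e ℚ.* e)) (ℚP.*-inverseʳ B) ⟩
      d ℚ.* 1ℚ                          ≡⟨ ℚP.*-identityʳ d ⟩
      d                                 ∎
      where
      open ≡-Reasoning

    -- Unfolding the operations on cuts, t lies below `x` when Y / b lies below √δ. Scaling by 1 /
    -- b² turns the comparison of Y² with m = δ b² into one of (Y / b)² with δ. A negative Y is
    -- below the root in any case.
    lower-cut : ∀ t → let Y = t ℚ.* C ℚ.- E in (0ℚ ℚ.≤ Y → Y ℚ.* Y ℚ.< m) → ℝ.L x t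
    lower-cut t Y²<m with t ℚ.* C ℚ.- E ℚP.<? 0ℚ
    ... | yes Y<0 = inj₁ (subst ((t ℚ.* C ℚ.- E) ℚ.* i ℚ.<_) (ℚP.*-zeroˡ i) (ℚP.*-monoˡ-<-pos i Y<0))
    ... | no  Y≮0 = inj₂ (subst₂ ℚ._<_ (square-scale (t ℚ.* C ℚ.- E)) m-scale
                      (ℚP.*-monoˡ-<-pos (i ℚ.* i) (Y²<m (ℚP.≮⇒≥ Y≮0))))

    upper-cut : ∀ t → let Y = t ℚ.* C ℚ.- E in 0ℚ ℚ.< Y → m ℚ.< Y ℚ.* Y → ℝ.U x t
    upper-cut t 0<Y m<Y² =
      subst (ℚ._< (t ℚ.* C ℚ.- E) ℚ.* i) (ℚP.*-zeroˡ i) (ℚP.*-monoˡ-<-pos i 0<Y) ,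
      subst₂ ℚ._<_ m-scale (square-scale (t ℚ.* C ℚ.- E)) (ℚP.*-monoˡ-<-pos (i ℚ.* i) m<Y²)

    ⟦form⟧ : ∀ x y → let X = C ℚ.* ⟦ x ⟧ ℚ.- E ℚ.* ⟦ y ⟧ in
      ⟦ form (+ a) (+ c) σ (x , y) ⟧ ≡ X ℚ.* X ℚ.- m ℚ.* (⟦ y ⟧ ℚ.* ⟦ y ⟧)
    ⟦form⟧ x y = trans (⟦⟧-sub (X * X) ((+ c * + c - σ) * (y * y))) (cong₂ ℚ._-_
      (trans (⟦⟧-* X X) (cong₂ ℚ._*_ ⟦X⟧ ⟦X⟧))
      (trans (⟦⟧-* (+ c * + c - σ) (y * y)) (cong₂ ℚ._*_ ⟦c²-σ⟧ (⟦⟧-* y y))))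
      where
      X = + c * x - (+ c - + a) * y
      ⟦X⟧ : ⟦ X ⟧ ≡ C ℚ.* ⟦ x ⟧ ℚ.- E ℚ.* ⟦ y ⟧
      ⟦X⟧ = trans (⟦⟧-sub (+ c * x) ((+ c - + a) * y))
        (cong₂ ℚ._-_ (⟦⟧-* (+ c) x) (⟦⟧-* (+ c - + a) y))
      ⟦c²-σ⟧ : ⟦ + c * + c - σ ⟧ ≡ m
      ⟦c²-σ⟧ = trans (cong ⟦_⟧ c²-σ)
        (trans (⟦⟧-* (+ δ) (+ b * + b)) (cong (d ℚ.*_) (⟦⟧-* (+ b) (+ b))))

  -- For the convergent s = N / D put X = s c - (c - a). The form takes the value (X² - m) D² at (N,
  -- D), so a bound K on it makes X² differ from m by less than ε once K < D² ε. As X ≥ 1, this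
  -- places √m within e = ε c of X, and dividing by c gives the claim.
  cf-approximates : ∀ a₀ {as} → 1 ≤ a₀ → All (1 ≤_) as →
    ∀ K → ∣ form (+ a) (+ c) σ (vec (a₀ ∷ as)) ∣ ≤ K →
    ∀ ε → 0ℚ ℚ.< ε → fromℕ K ℚ.< fromℕ (length as) ℚ.* ε →
    ℝ.L x (cf a₀ as ℚ.- ε) × ℝ.U x (cf a₀ as ℚ.+ ε)
  cf-approximates a₀ {as} a₀≥1 as≥1 K form≤K ε 0<ε K<lε =
    lower-cut (s ℚ.- ε) (λ 0≤Y → subst (λ y → y ℚ.* y ℚ.< m) (sym Y≡)
      (square-below 1≤X 0<e (ℚP.<-≤-trans X²-m<ε ε≤e) (subst (0ℚ ℚ.≤_) Y≡ 0≤Y))) ,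
    upper-cut (s ℚ.+ ε)
      (subst (0ℚ ℚ.<_) (sym Z≡) (ℚP.+-mono-< (ℚP.<-≤-trans (ℚP.positive⁻¹ 1ℚ) 1≤X) 0<e))
      (subst (λ y → m ℚ.< y ℚ.* y) (sym Z≡) (square-above 1≤X 0<e (ℚP.<-≤-trans m-X²<ε ε≤e)))
    where
    s D N X e F : ℚ
    s = cf a₀ as
    D = fromℕ (den (a₀ ∷ as))
    N = fromℕ (num (a₀ ∷ as))
    X = s ℚ.* C ℚ.- E
    e = ε ℚ.* C
    F = ⟦ form (+ a) (+ c) σ (vec (a₀ ∷ as)) ⟧

    instance
      D>0 : ℚ.Positive D
      D>0 = fromℕ-positive (den (a₀ ∷ as)) {{ℕ.>-nonZero (num≥1 as≥1)}}
      D²>0 : ℚ.Positive (D ℚ.* D)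
      D²>0 = ℚP.pos*pos⇒pos D D
      D²≥0 : ℚ.NonNegative (D ℚ.* D)
      D²≥0 = ℚP.pos⇒nonNeg (D ℚ.* D)
      ε≥0 : ℚ.NonNegative ε
      ε≥0 = ℚ.nonNegative (ℚP.<⇒≤ 0<ε)
      C≥0 : ℚ.NonNegative C
      C≥0 = ℚP.normalize-nonNeg c 1

    sD≡N : s ℚ.* D ≡ N
    sD≡N = cf-num-den a₀ as≥1

    Y≡ : (s ℚ.- ε) ℚ.* C ℚ.- E ≡ X ℚ.- e
    Y≡ = solve 4 (λ s ε C E → (s :- ε) :* C :- E := (s :* C :- E) :- ε :* C) refl s ε C E

    Z≡ : (s ℚ.+ ε) ℚ.* C ℚ.- E ≡ X ℚ.+ e
    Z≡ = solve 4 (λ s ε C E → (s :+ ε) :* C :- E := (s :* C :- E) :+ ε :* C) refl s ε C E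

    ε≤e : ε ℚ.≤ e
    ε≤e = subst (ℚ._≤ e) (ℚP.*-identityʳ ε)
      (ℚP.*-monoˡ-≤-nonNeg ε (fromℕ-mono-≤ {1} {c} (ℕ.>-nonZero⁻¹ c)))

    0<e : 0ℚ ℚ.< e
    0<e = ℚP.<-≤-trans 0<ε ε≤e

    1≤s : 1ℚ ℚ.≤ s
    1≤s = ℚP.*-cancelʳ-≤-pos D (subst₂ ℚ._≤_ (sym (ℚP.*-identityˡ D)) (sym sD≡N)
      (fromℕ-mono-≤ {den (a₀ ∷ as)} {num (a₀ ∷ as)} (den≤num as a₀≥1)))

    -- From s ≥ 1 follows X ≥ c - (c - a) = a ≥ 1, which keeps the convergent on the side of the
    -- positive root.
    1≤X : 1ℚ ℚ.≤ X
    1≤X = begin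
      1ℚ                      ≤⟨ fromℕ-mono-≤ {1} {a} (ℕ.>-nonZero⁻¹ a) ⟩
      fromℕ a                 ≡⟨ cong ⟦_⟧ (difference (+ c) (+ a)) ⟨
      ⟦ + c - (+ c - + a) ⟧   ≡⟨ ⟦⟧-sub (+ c) (+ c - + a) ⟩
      C ℚ.- E                 ≡⟨ cong (ℚ._- E) (ℚP.*-identityˡ C) ⟨
      1ℚ ℚ.* C ℚ.- E          ≤⟨ ℚP.+-monoˡ-≤ (ℚ.- E) (ℚP.*-monoʳ-≤-nonNeg C 1≤s) ⟩
      X                       ∎
      where
      open ℚP.≤-Reasoning
      difference : ∀ c a → c - (c - a) ≡ a
      difference = solve-∀

    X²D² : (X ℚ.* X ℚ.- m) ℚ.* (D ℚ.* D) ≡ F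
    X²D² = begin
      (X ℚ.* X ℚ.- m) ℚ.* (D ℚ.* D)
        ≡⟨ solve 5 (λ s C E m D → ((s :* C :- E) :* (s :* C :- E) :- m) :* (D :* D)
             := (C :* (s :* D) :- E :* D) :* (C :* (s :* D) :- E :* D) :- m :* (D :* D)) refl s C E m D ⟩
      (C ℚ.* (s ℚ.* D) ℚ.- E ℚ.* D) ℚ.* (C ℚ.* (s ℚ.* D) ℚ.- E ℚ.* D) ℚ.- m ℚ.* (D ℚ.* D)
        ≡⟨ cong (λ N → (C ℚ.* N ℚ.- E ℚ.* D) ℚ.* (C ℚ.* N ℚ.- E ℚ.* D) ℚ.- m ℚ.* (D ℚ.* D)) sD≡N ⟩
      (C ℚ.* N ℚ.- E ℚ.* D) ℚ.* (C ℚ.* N ℚ.- E ℚ.* D) ℚ.- m ℚ.* (D ℚ.* D)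
        ≡⟨ ⟦form⟧ (+ num (a₀ ∷ as)) (+ den (a₀ ∷ as)) ⟨
      F ∎
      where open ≡-Reasoning

    small : ∀ y → y ℚ.* (D ℚ.* D) ℚ.≤ fromℕ K → y ℚ.< ε
    small y yD²≤K = ℚP.*-cancelʳ-<-nonNeg (D ℚ.* D) (begin-strict
      y ℚ.* (D ℚ.* D)                  ≤⟨ yD²≤K ⟩
      fromℕ K                          <⟨ K<lε ⟩
      fromℕ (length as) ℚ.* ε          ≤⟨ ℚP.*-monoʳ-≤-nonNeg ε (fromℕ-mono-≤ {length as} {q ℕ.* q} l≤q²) ⟩
      fromℕ (q ℕ.* q) ℚ.* ε            ≡⟨ cong (ℚ._* ε) (fromℕ-* q q) ⟩
      D ℚ.* D ℚ.* ε                    ≡⟨ ℚP.*-comm (D ℚ.* D) ε ⟩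
      ε ℚ.* (D ℚ.* D)                  ∎)
      where
      open ℚP.≤-Reasoning
      q = den (a₀ ∷ as)
      -- The denominator q of the whole list is by definition `num as`, so the linear growth bound
      -- applies to it.
      l≤q² : length as ≤ q ℕ.* q
      l≤q² = ℕP.≤-trans (length≤num as≥1) (ℕP.m≤m*n q q {{ℕ.>-nonZero (num≥1 as≥1)}})

    F≤K : ∀ z → ∣ z ∣ ≤ K → ⟦ z ⟧ ℚ.≤ fromℕ K
    F≤K z ∣z∣≤K = ⟦⟧-mono-≤ {z} {+ K} (ℤP.≤-trans (≤∣∣ z) (ℤ.+≤+ ∣z∣≤K))
      where
      ≤∣∣ : ∀ z → z ℤ.≤ + ∣ z ∣
      ≤∣∣ (+ n)    = ℤP.≤-refl
      ≤∣∣ -[1+ n ] = ℤ.-≤+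

    X²-m<ε : X ℚ.* X ℚ.- m ℚ.< ε
    X²-m<ε = small (X ℚ.* X ℚ.- m) (subst (ℚ._≤ fromℕ K) (sym X²D²)
      (F≤K (form (+ a) (+ c) σ (vec (a₀ ∷ as))) form≤K))

    m-X²<ε : m ℚ.- X ℚ.* X ℚ.< ε
    m-X²<ε = small (m ℚ.- X ℚ.* X) (subst (ℚ._≤ fromℕ K)
      (trans (⟦⟧-neg f) (trans (cong ℚ.-_ (sym X²D²))
        (solve 3 (λ X m D → :- ((X :* X :- m) :* (D :* D)) := (m :- X :* X) :* (D :* D)) refl X m D)))
      (F≤K (- f) (ℕP.≤-trans (ℕP.≤-reflexive (ℤP.∣-i∣≡∣i∣ f)) form≤K)))
      where f = form (+ a) (+ c) σ (vec (a₀ ∷ as))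

  -- Only the matrix of `u` matters: it preserves the form, so one K bounds the form on all
  -- convergents, and N is chosen with K < N ε.
  pell-expansion : σ ≡ 1ℤ ⊎ σ ≡ -1ℤ → ∀ u → All (1 ≤_) (toList u) →
    word (toList u) ≡ pell (+ a) (+ c) σ → x ≈[ u ]ᵖ
  pell-expansion σ≡±1 u u≥1 word≡pell = u≥1 , λ ε 0<ε →
    let K , form≤K = cycle-form-bounded (form (+ a) (+ c) σ) u λ v →
          trans (cong (λ M → form (+ a) (+ c) σ (M ▹ v)) word≡pell) (form-pell (+ a) (+ c) σ≡±1 v)
        N , K<Nε = archimedean 0<ε K
    -- The convergent of index k consists of k + 1 entries, so the bound on the form is taken at
    -- `suc k`, while the list after the leading entry has length k.
    in N , λ k N≤k →
      cf-approximates (cycle u 0) (cycle-positive u u≥1 0)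
        (All.applyUpTo⁺₂ (λ i → cycle u (suc i)) k (λ i → cycle-positive u u≥1 (suc i)))
        K (form≤K (suc k)) ε 0<ε
        (ℚP.<-≤-trans K<Nε (ℚP.*-monoʳ-≤-nonNeg ε {{ℚ.nonNegative (ℚP.<⇒≤ 0<ε)}}
          (fromℕ-mono-≤ (ℕP.≤-trans N≤k
            (ℕP.≤-reflexive (sym (List.length-applyUpTo (λ i → cycle u (suc i)) k)))))))

-- Choice of the sign and conclusion.

signs : ∀ {σ d} → σ ≡ 1ℤ ⊎ σ ≡ -1ℤ → d ≡ 1ℤ ⊎ d ≡ -1ℤ → d ≡ σ ⊎ - d ≡ σ
signs (inj₁ refl) (inj₁ refl) = inj₁ refl
signs (inj₁ refl) (inj₂ refl) = inj₂ refl
signs (inj₂ refl) (inj₁ refl) = inj₂ refl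
signs (inj₂ refl) (inj₂ refl) = inj₁ refl

-- The leading 0 inverts the fraction, so a / c equals den / num. Both are in lowest terms and hence
-- agree entrywise. This identifies the first column of the word matrix.
cf-lowest-terms : ∀ a c .{{_ : NonZero c}} → Coprime a c → ∀ {b bs} → All (1 ≤_) (b ∷ bs) →
  + a / c ≡ cf 0 (b ∷ bs) → vec (b ∷ bs) ≡ (+ c , + a)
cf-lowest-terms a c a⊥c {b} {bs} bs≥1 a/c≡cf =
  let a≡q , c≡p = coprime-unique a⊥c (Coprime.sym (num-den-coprime (b ∷ bs))) cross
  in cong₂ _,_ (cong +_ (sym c≡p)) (cong +_ (sym a≡q))
  where
  p = num (b ∷ bs)
  q = den (b ∷ bs)
  cross : a ℕ.* p ≡ q ℕ.* c
  cross = ℤP.+-injective (⟦⟧-injective {+ (a ℕ.* p)} {+ (q ℕ.* c)} (begin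
    fromℕ (a ℕ.* p)                       ≡⟨ fromℕ-* a p ⟩
    fromℕ a ℚ.* fromℕ p                   ≡⟨ cong (ℚ._* fromℕ p) (/-*-cancel (+ a) c) ⟨
    + a / c ℚ.* fromℕ c ℚ.* fromℕ p       ≡⟨ solve 3 (λ r c p → r :* c :* p := r :* p :* c) refl (+ a / c) (fromℕ c) (fromℕ p) ⟩
    + a / c ℚ.* fromℕ p ℚ.* fromℕ c       ≡⟨ cong (λ r → r ℚ.* fromℕ p ℚ.* fromℕ c) a/c≡cf ⟩
    cf 0 (b ∷ bs) ℚ.* fromℕ p ℚ.* fromℕ c ≡⟨ cong (ℚ._* fromℕ c) (cf-num-den 0 bs≥1) ⟩
    fromℕ q ℚ.* fromℕ c                   ≡⟨ fromℕ-* q c ⟨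
    fromℕ (q ℕ.* c)                       ∎))
    where
    open ≡-Reasoning

mainTheorem4 : (a b c δ : ℕ) .{{_ : NonZero a}} .{{_ : NonZero b}} .{{_ : NonZero c}} .{{_ : NonZero δ}} →
    ((+ c) ^ 2 - (+ δ) * (+ b) ^ 2 ≡ 1ℤ) ⊎ ((+ c) ^ 2 - (+ δ) * (+ b) ^ 2 ≡ -1ℤ) →
    Coprime a c → a < c →
    (a₁ : ℕ) (as : List ℕ) → All (1 ≤_) (a₁ ∷ as) → (+ a) / c ≡ cf 0 (a₁ ∷ as) →
    ((((+ c - + a) / 1) ⊕ (b ⊙ (√ δ))) ⊘ c ≈[ contract (firstPeriod a₁ as) ]ᵖ)
    ⊎ ((((+ c - + a) / 1) ⊕ (b ⊙ (√ δ))) ⊘ c ≈[ contract (secondPeriod a₁ as) ]ᵖ)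
mainTheorem4 a b c δ pell-eq a⊥c a<c a₁ as as≥1 a/c≡cf = [ inj₁ ∘ first , inj₂ ∘ second ]′ (signs pell-eq (det-word (a₁ ∷ as)))
  where
  open Mat (word (a₁ ∷ as))
  σ : ℤ
  σ = (+ c) ^ 2 - (+ δ) * (+ b) ^ 2

  c²-σ : + c * + c - σ ≡ + δ * (+ b * + b)
  c²-σ = identity (+ b) (+ c) (+ δ)
    where
    identity : ∀ b c δ → c * c - (c * (c * 1ℤ) - δ * (b * (b * 1ℤ))) ≡ δ * (b * b)
    identity = solve-∀

  vec≡ : vec (a₁ ∷ as) ≡ (+ c , + a)
  vec≡ = cf-lowest-terms a c a⊥c as≥1 a/c≡cf

  column : (m₁₁ , m₂₁) ≡ (+ c , + a)
  column = trans (word-column (a₁ ∷ as)) vec≡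

  -- For n = 1 the pair `vec≡` reads c = a₁ and a = 1, so a < c is the required bound.
  a₁≥2 : as ≡ [] → 2 ≤ a₁
  a₁≥2 refl = subst₂ ℕ._<_ (ℤP.+-injective (cong proj₂ (sym vec≡)))
    (trans (ℤP.+-injective (cong proj₁ (sym vec≡)))
      (trans (ℕP.+-identityʳ (a₁ ℕ.* 1)) (ℕP.*-identityʳ a₁))) a<c

  -- The determinant and σ are both ±1. If they agree, S W S Wᵀ is the automorphism of the form for
  -- this σ; if they are opposite, S W Sᵀ Wᵀ is.
  first : det (word (a₁ ∷ as)) ≡ σ →
    (((+ c - + a) / 1) ⊕ (b ⊙ (√ δ))) ⊘ c ≈[ contract (firstPeriod a₁ as) ]ᵖ
  first d≡σ = pell-expansion a b c δ σ c²-σ pell-eq (contract (firstPeriod a₁ as))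
    (firstPeriod-positive a₁ as as≥1 a₁≥2) (begin
      word (toList (contract (firstPeriod a₁ as)))   ≡⟨ word-contract (firstPeriod a₁ as) ⟩
      word (toList (firstPeriod a₁ as))              ≡⟨ word-firstPeriod a₁ as as≥1 ⟩
      S ∙ (word (a₁ ∷ as) ∙ (S ∙ word (a₁ ∷ as) ᵀ))  ≡⟨ S-congruence m₁₁ m₁₂ m₂₁ m₂₂ ⟩
      pell m₂₁ m₁₁ (det (word (a₁ ∷ as)))            ≡⟨ cong₂ (λ v d → pell (proj₂ v) (proj₁ v) d) column d≡σ ⟩
      pell (+ a) (+ c) σ                             ∎)
    where open ≡-Reasoning

  second : - det (word (a₁ ∷ as)) ≡ σ →
    (((+ c - + a) / 1) ⊕ (b ⊙ (√ δ))) ⊘ c ≈[ contract (secondPeriod a₁ as) ]ᵖ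
  second -d≡σ = pell-expansion a b c δ σ c²-σ pell-eq (contract (secondPeriod a₁ as))
    (secondPeriod-positive a₁ as as≥1) (begin
      word (toList (contract (secondPeriod a₁ as)))    ≡⟨ word-contract (secondPeriod a₁ as) ⟩
      word (toList (secondPeriod a₁ as))               ≡⟨ word-secondPeriod a₁ as as≥1 a₁≥2 ⟩
      S ∙ (word (a₁ ∷ as) ∙ (S ᵀ ∙ word (a₁ ∷ as) ᵀ))  ≡⟨ Sᵀ-congruence m₁₁ m₁₂ m₂₁ m₂₂ ⟩
      pell m₂₁ m₁₁ (- det (word (a₁ ∷ as)))            ≡⟨ cong₂ (λ v d → pell (proj₂ v) (proj₁ v) d) column -d≡σ ⟩
      pell (+ a) (+ c) σ                               ∎)
    where open ≡-Reasoning
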